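{- If $q$ is an odd prime number and $n=q^2+q+1$, then \[ \frac{q+1}{4}(n+1)\leq A_{\alpha}(K_n).\]
   Context: All graphs are finite and simple. For a graph $G$, the achromatic arboricity $A_{\alpha}(G)$ is the largest integer $k$ for which there is a surjective coloring $\varsigma\colon E(G)\to\{1,\dots,k\}$ of the edges of $G$ such that every color class $\varsigma^{ -1}(i)$ induces an acyclic subgraph (a forest), and for any two distinct colors $i\neq j$ the subgraph formed by the edges of $\varsigma^{ -1}(i)\cup\varsigma^{ -1}(j)$ contains at least one cycle. $K_n$ denotes the complete graph on $n$ vertices. -}

module Defs where

open import Data.Nat using (ℕ; _≤_)
open import Data.Fin using (Fin)
open import Data.List using (List; []; _∷_; _++_; length)
open import Data.List.Relation.Unary.Linked using (Linked)
open import Data.List.Relation.Unary.Unique.Propositional using (Unique)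
open import Data.Product using (Σ; ∃; _×_)
open import Data.Sum using (_⊎_)
open import Relation.Binary.PropositionalEquality using (_≡_; _≢_)
open import Relation.Nullary using (¬_)

-- A (spanning) subgraph of K_n on vertex set Fin n, given by an edge relation.
Rel : ℕ → Set₁
Rel n = Fin n → Fin n → Set

-- A cycle in the subgraph E: distinct vertices x, v₁, …, v_m with m ≥ 2
-- (so at least 3 vertices), consecutive ones adjacent, and v_m adjacent to x.
HasCycle : {n : ℕ} → Rel n → Set
HasCycle {n} E =
  Σ (Fin n) λ x → Σ (List (Fin n)) λ vs →
    (2 ≤ length vs) × Unique (x ∷ vs) × Linked E (x ∷ (vs ++ (x ∷ [])))

Acyclic : {n : ℕ} → Rel n → Set
Acyclic E = ¬ HasCycle E

-- Edge colouring of K_n with colours Fin k: a symmetric map on pairs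
-- (values on the diagonal u = u are irrelevant: they are not edges).
record Colouring (n k : ℕ) : Set where
  field
    col : Fin n → Fin n → Fin k
    sym : ∀ u v → col u v ≡ col v u
open Colouring public

ColourClass : {n k : ℕ} → Colouring n k → Fin k → Rel n
ColourClass c i u v = (u ≢ v) × (col c u v ≡ i)

TwoColourClass : {n k : ℕ} → Colouring n k → Fin k → Fin k → Rel n
TwoColourClass c i j u v = (u ≢ v) × ((col c u v ≡ i) ⊎ (col c u v ≡ j))

Surjective : {n k : ℕ} → Colouring n k → Set
Surjective {n} c = ∀ i → Σ (Fin n) λ u → Σ (Fin n) λ v → (u ≢ v) × (col c u v ≡ i)

IsCompleteAcyclic : {n k : ℕ} → Colouring n k → Set
IsCompleteAcyclic c =
  Surjective c
  × (∀ i → Acyclic (ColourClass c i))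
  × (∀ i j → i ≢ j → HasCycle (TwoColourClass c i j))

Attainable : ℕ → ℕ → Set
Attainable n k = Σ (Colouring n k) IsCompleteAcyclic

IsAchromaticArboricityK : ℕ → ℕ → Set
IsAchromaticArboricityK n a = Attainable n a × (∀ k → Attainable n k → k ≤ a)

{-# OPTIONS --safe #-}
module Submission where

-- Let K be the field F_q[x]/(x³ - x - k), where k is chosen outside the image of t ↦ t³ - t. The
-- group K*/F_q* is abelian of order n = q² + q + 1, and the classes δ of the q + 1 polynomials of
-- degree at most one form a planar difference set in it: every element is a quotient of two of
-- them, and by unique factorisation δ i ∙ δ j determines {i, j}. Its translates δ ∙ u are the lines
-- of a projective plane on n points.
-- Write q + 1 = 2h. Every line carries a K_{2h}, which decomposes into h spanning double stars.
-- Each colour is the union of one double star on the line of u and the corresponding one on the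
-- line of u⁻¹; it is a tree because two lines share one point. Two colours on the same pair of
-- lines span the same points, and two on different pairs have two common points, unless the four
-- lines pass through a point p; but then p² = δ i ∙ δ j = δ k ∙ δ l forces the pairs to be equal.
-- There are at least (n + 1)/2 pairs {u, u⁻¹}, hence at least h (n + 1)/2 colours.

open import Defs hiding (sym)
open import Algebra.Bundles using (AbelianGroup)
open import Algebra.Structures using (IsAbelianGroup)
open import Data.Bool using (Bool; true; false; not)
import Data.Bool.Properties as Bool
open import Data.Empty using (⊥)
open import Data.Fin using (Fin; zero; suc; toℕ; fromℕ<; combine; punchOut)
import Data.Fin as Fin
import Data.Fin.Properties as Fin
open import Data.Integer using (ℤ; 0ℤ; 1ℤ)
import Data.Integer.Properties as ℤ
open import Data.Integer.DivMod using (_%ℕ_; _/ℕ_; n%ℕd<d; a≡a%ℕn+[a/ℕn]*n)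
open import Data.Integer.Divisibility.Signed using (_∣_; divides; ∣⇒∣ᵤ; ∣ᵤ⇒∣; _∣?_; ∣m∣n⇒∣m+n; ∣n⇒∣m*n)
open import Data.Integer.Tactic.RingSolver using (solve-∀)
open import Data.List using (List; []; _∷_; _++_)
open import Data.List.Membership.Propositional using (_∈_)
open import Data.List.Relation.Unary.All as All using (All; []; _∷_)
open import Data.List.Relation.Unary.All.Properties using (¬Any⇒All¬)
open import Data.List.Relation.Unary.AllPairs using ([]; _∷_)
open import Data.List.Relation.Unary.Any using (here; there; any?)
open import Data.List.Relation.Unary.Linked using (Linked; [-]; _∷_)
open import Data.List.Relation.Unary.Unique.Propositional using (Unique)
open import Data.Nat using (ℕ; zero; suc; _≤_; _<_; z≤n; s≤s; _≤?_; _%_; NonZero)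
import Data.Nat as ℕ
import Data.Nat.Properties as ℕ
import Data.Nat.Divisibility as ℕ using (_∣_; ∣1⇒≡1; >⇒∤)
import Data.Nat.Tactic.RingSolver as ℕ-Solver
open import Data.Nat.Coprimality using (prime⇒coprime; coprime-Bézout)
open import Data.Nat.DivMod using (m≡m%n+[m/n]*n)
open import Data.Nat.GCD using (module Bézout)
open import Data.Nat.Primality using (Prime; ¬prime[1]; euclidsLemma; prime⇒nonZero)
open import Data.Product using (∃; ∃₂; _×_; _,_; proj₁; proj₂)
open import Data.Product.Function.NonDependent.Propositional using (_×-↔_)
open import Data.Product.Properties using (≡-dec)
open import Data.Sum using (_⊎_; inj₁; inj₂; [_,_]′)
import Data.Sum as Sum
open import Data.Sum.Function.Propositional using (_⊎-↔_)
open import Function using (_∘_; id; _↔_; Inverse)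
open import Function.Properties.Inverse using (↔-refl; ↔-trans; ↔-sym)
open import Relation.Binary.Construct.Closure.ReflexiveTransitive using (Star; ε; _◅_; _◅◅_)
import Relation.Binary.Construct.Closure.ReflexiveTransitive as Star
open import Relation.Binary.PropositionalEquality using (_≡_; _≢_; refl; sym; trans; cong; cong₂; subst; subst₂; ≢-sym; isEquivalence; module ≡-Reasoning)
open import Relation.Nullary using (¬_; Dec; yes; no; contradiction)
open import Relation.Nullary.Decidable using (map′; _⊎-dec_; _×-dec_)
open import Relation.Unary using (Decidable)

-- Acyclicity of graphs ranked so that every vertex has at most one non-ascending edge.

module Ranking {n : ℕ} {E : Rel n} (E-sym : ∀ {u v} → E u v → E v u) (rank : Fin n → ℕ)
  (down-unique : ∀ {v x y} → E v x → E v y → rank x ≤ rank v → rank y ≤ rank v → x ≡ y) where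

  -- Entering a vertex from below uses up its only non-ascending edge, so a path that
  -- climbs once keeps climbing.
  ascend : ∀ {x p c} → E p c → rank p ≤ rank c → ∀ cs → Linked E (c ∷ cs ++ x ∷ []) →
    Unique (p ∷ c ∷ cs) → All (x ≢_) (p ∷ c ∷ cs) →
    ∃ λ l → l ∈ c ∷ cs × E l x × rank c ≤ rank l × rank l < rank x
  ascend {x} {p} {c} p~c p≤c [] (c~x ∷ _) _ (x≢p ∷ _) =
    c , here refl , c~x , ℕ.≤-refl ,
    ℕ.≰⇒> λ x≤c → x≢p (down-unique c~x (E-sym p~c) x≤c p≤c)
  ascend {x} {p} {c} p~c p≤c (d ∷ ds) (c~d ∷ ls) ((_ ∷ p≢d ∷ _) ∷ uniq) (_ ∷ x∉)
    with rank d ≤? rank c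
  ... | yes d≤c = contradiction (down-unique (E-sym p~c) c~d p≤c d≤c) p≢d
  ... | no d≰c =
    let c≤d = ℕ.<⇒≤ (ℕ.≰⇒> d≰c)
        l , l∈ , l~x , d≤l , l<x = ascend c~d c≤d ds ls uniq x∉
    in l , there l∈ , l~x , ℕ.≤-trans c≤d d≤l , l<x

  -- While the path descends, the bound `rank l ≤ rank c` is passed along; the first step that does
  -- not descend hands over to `ascend`, which yields `rank l < rank x`.
  final-edge : ∀ {x c} cs → Linked E (c ∷ cs ++ x ∷ []) → Unique (c ∷ cs) → All (x ≢_) (c ∷ cs) →
    ∃ λ l → l ∈ c ∷ cs × E l x × (rank l ≤ rank c ⊎ rank l < rank x)
  final-edge {c = c} [] (c~x ∷ _) _ _ = c , here refl , c~x , inj₁ ℕ.≤-refl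
  final-edge {c = c} (d ∷ ds) (c~d ∷ ls) uniq@(_ ∷ uniq′) x∉@(_ ∷ x∉′) with rank c ≤? rank d
  ... | yes c≤d =
    let l , l∈ , l~x , _ , l<x = ascend c~d c≤d ds ls uniq x∉
    in l , there l∈ , l~x , inj₂ l<x
  ... | no c≰d with final-edge ds ls uniq′ x∉′
  ...   | l , l∈ , l~x , inj₁ l≤d = l , there l∈ , l~x , inj₁ (ℕ.≤-trans l≤d (ℕ.<⇒≤ (ℕ.≰⇒> c≰d)))
  ...   | l , l∈ , l~x , inj₂ l<x = l , there l∈ , l~x , inj₂ l<x

  -- If the vertex v after x is not above x, neither is the last vertex, and x has two non-ascending
  -- edges. Otherwise the only non-ascending edge of v is the one to x, so the cycle climbs from v
  -- on, even on its last step into x, which lies below v.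
  acyclic : Acyclic E
  acyclic (x , [] , () , _)
  acyclic (x , _ ∷ [] , s≤s () , _)
  acyclic (x , v ∷ w ∷ vs , _ , x∉@(x≢v ∷ x≢w ∷ _) ∷ uniq@((v≢w ∷ v∉) ∷ uniq′) , x~v ∷ v~w ∷ ls)
    with rank v ≤? rank x
  ... | yes v≤x =
    let l , l∈ , l~x , l≤x = last-below
    in contradiction (down-unique x~v (E-sym l~x) v≤x l≤x) (All.lookup (v≢w ∷ v∉) l∈)
    where
    last-below : ∃ λ l → l ∈ w ∷ vs × E l x × rank l ≤ rank x
    last-below with rank v ≤? rank w
    ... | yes v≤w =
      let l , l∈ , l~x , _ , l<x = ascend v~w v≤w vs ls uniq x∉
      in l , l∈ , l~x , ℕ.<⇒≤ l<x
    ... | no v≰w with final-edge vs ls uniq′ (All.tail x∉)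
    ...   | l , l∈ , l~x , inj₁ l≤w = l , l∈ , l~x , ℕ.≤-trans l≤w (ℕ.≤-trans (ℕ.<⇒≤ (ℕ.≰⇒> v≰w)) v≤x)
    ...   | l , l∈ , l~x , inj₂ l<x = l , l∈ , l~x , ℕ.<⇒≤ l<x
  ... | no v≰x with rank w ≤? rank v
  ...   | yes w≤v = x≢w (down-unique (E-sym x~v) v~w (ℕ.<⇒≤ (ℕ.≰⇒> v≰x)) w≤v)
  ...   | no w≰v =
    let _ , _ , _ , w≤l , l<x = ascend v~w (ℕ.<⇒≤ (ℕ.≰⇒> w≰v)) vs ls uniq x∉
    in ℕ.<-asym (ℕ.<-trans (ℕ.≰⇒> v≰x) (ℕ.≰⇒> w≰v)) (ℕ.≤-<-trans w≤l l<x)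

-- Simple paths, and cycles from edge-disjoint walks.

data Path {n : ℕ} (E : Rel n) : Fin n → List (Fin n) → Fin n → Set where
  stop : ∀ {x} → Path E x [] x
  step : ∀ {x v vs y} → E x v → All (x ≢_) (v ∷ vs) → Path E v vs y → Path E x (v ∷ vs) y

module _ {n : ℕ} {E : Rel n} where

  path-suffix : ∀ {x y z vs} → Path E x vs y → z ∈ x ∷ vs → ∃ λ ws → Path E z ws y
  path-suffix p (here refl) = _ , p
  path-suffix (step _ _ p) (there z∈) = path-suffix p z∈

  -- If the start x recurs on the erased tail, the part of the tail from that occurrence on already
  -- leads from x to the end.
  loop-erase : ∀ {x y} → Star E x y → ∃ λ vs → Path E x vs y
  loop-erase ε = [] , stop
  loop-erase {x} (_◅_ {j = v} e w) with loop-erase w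
  ... | vs , p with any? (x Fin.≟_) (v ∷ vs)
  ...   | yes x∈ = path-suffix p x∈
  ...   | no x∉ = v ∷ vs , step e (¬Any⇒All¬ _ x∉) p

  path-unique : ∀ {x vs y} → Path E x vs y → Unique (x ∷ vs)
  path-unique stop = [] ∷ []
  path-unique (step _ x∉ p) = x∉ ∷ path-unique p

  path-closed : ∀ {F : Rel n} → (∀ {u v} → E u v → F u v) → ∀ {x vs y z} → Path E x vs y → F y z →
    Linked F (x ∷ vs ++ z ∷ [])
  path-closed E⊆F stop y~z = y~z ∷ [-]
  path-closed E⊆F (step e _ p) y~z = E⊆F e ∷ path-closed E⊆F p y~z

  path-avoids : ∀ {x v vs y z} → All (z ≢_) (v ∷ vs) → Path E v vs y →
    Star (λ u w → E u w × ¬ (u ≡ x × w ≡ z)) v y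
  path-avoids _ stop = ε
  path-avoids (_ ∷ z∉@(z≢w ∷ _)) (step e _ p) =
    (e , λ (_ , w≡z) → z≢w (sym w≡z)) ◅ path-avoids z∉ p

-- Loop erasure leaves a simple path from a to b. It has at least two edges, because a single edge
-- would be the excluded step, so the edge from b to a closes it to a genuine cycle.
closed-walk⇒cycle : ∀ {n} {E : Rel n} {a b} → a ≢ b → E b a →
  Star (λ u v → E u v × ¬ (u ≡ a × v ≡ b)) a b → HasCycle E
closed-walk⇒cycle a≢b b~a w with loop-erase w
... | [] , stop = contradiction refl a≢b
... | _ ∷ [] , step (_ , avoids) _ stop = contradiction (refl , refl) avoids
... | vs@(_ ∷ _ ∷ _) , p = _ , vs , s≤s (s≤s z≤n) , path-unique p , path-closed proj₁ p b~a

-- The loop-erased F-walk starts with an edge from x to some v. The rest of that path followed by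
-- the E-walk leads from v to y and on to x without using this edge: the path does not revisit x,
-- and no E-edge is an F-edge.
edge-disjoint-walks⇒cycle : ∀ {n} {E F H : Rel n} →
  (∀ {u v} → F u v → F v u) → (∀ {u v} → E u v → F u v → ⊥) →
  (∀ {u v} → E u v → H u v) → (∀ {u v} → F u v → H u v) →
  ∀ {x y} → x ≢ y → Star F x y → Star E y x → HasCycle H
edge-disjoint-walks⇒cycle F-sym disjoint E⊆H F⊆H x≢y wF wE with loop-erase wF
... | [] , stop = contradiction refl x≢y
... | _ ∷ _ , step x~v x∉@(x≢v ∷ _) p =
  closed-walk⇒cycle (≢-sym x≢v) (F⊆H x~v)
    (Star.map (λ (f , avoids) → F⊆H f , avoids) (path-avoids x∉ p) ◅◅
     Star.map (λ e → E⊆H e , λ { (refl , refl) → disjoint e (F-sym x~v) }) wE)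

-- Decomposition of the complete graph on 2h vertices into h double stars.

module DoubleStars (h : ℕ) where

  X : Set
  X = Fin h × Bool

  _≟X_ : (x y : X) → Dec (x ≡ y)
  _≟X_ = ≡-dec Fin._≟_ Bool._≟_

  least greatest : Fin h → Fin h → Fin h
  least i j with i Fin.≤? j
  ... | yes _ = i
  ... | no _ = j
  greatest i j with i Fin.≤? j
  ... | yes _ = j
  ... | no _ = i

  -- The colour class of c is the double star whose two centres are (c , true) and (c , false).
  τ : X → X → Fin h
  τ (i , s) (j , t) with s Bool.≟ t
  ... | yes _ = least i j
  ... | no _ = greatest i j

  least-comm : ∀ i j → least i j ≡ least j i
  least-comm i j with i Fin.≤? j | j Fin.≤? i
  ... | yes p | yes q = Fin.≤-antisym p q
  ... | yes p | no q = refl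
  ... | no p | yes q = refl
  ... | no p | no q = contradiction (ℕ.<⇒≤ (ℕ.≰⇒> p)) q

  greatest-comm : ∀ i j → greatest i j ≡ greatest j i
  greatest-comm i j with i Fin.≤? j | j Fin.≤? i
  ... | yes p | yes q = Fin.≤-antisym q p
  ... | yes p | no q = refl
  ... | no p | yes q = refl
  ... | no p | no q = contradiction (ℕ.<⇒≤ (ℕ.≰⇒> p)) q

  τ-comm : ∀ x y → τ x y ≡ τ y x
  τ-comm (i , s) (j , t) with s Bool.≟ t | t Bool.≟ s
  ... | yes _ | yes _ = least-comm i j
  ... | no _ | no _ = greatest-comm i j
  ... | yes p | no q = contradiction (sym p) q
  ... | no p | yes q = contradiction (sym q) p

  module Star-at (c : Fin h) where

    T : X → X → Set
    T x y = x ≢ y × τ x y ≡ c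

    T-sym : ∀ {x y} → T x y → T y x
    T-sym {x} {y} (x≢y , eq) = ≢-sym x≢y , trans (τ-comm y x) eq

    -- A centre adjacent to the given vertex: of the opposite sign if i ≤ c, as `greatest i c` is
    -- then c, and of the same sign if i > c, as `least i c` is then c. The two centres are each
    -- other's `par`.
    par : X → X
    par (i , s) with i Fin.≤? c
    ... | yes _ = c , not s
    ... | no _ = c , s

    par-centre : ∀ x → proj₁ (par x) ≡ c
    par-centre (i , s) with i Fin.≤? c
    ... | yes _ = refl
    ... | no _ = refl

    par-of-centre : ∀ s → par (c , s) ≡ (c , not s)
    par-of-centre s with c Fin.≤? c
    ... | yes _ = refl
    ... | no c≰c = contradiction ℕ.≤-refl c≰c

    par-edge : ∀ x → T x (par x)
    par-edge (i , s) with i Fin.≤? c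
    ... | yes i≤c = (λ eq → Bool.not-¬ refl (cong proj₂ eq)) , colour
      where
      colour : τ (i , s) (c , not s) ≡ c
      colour with s Bool.≟ not s
      ... | yes eq = contradiction eq (Bool.not-¬ refl)
      ... | no _ with i Fin.≤? c
      ...   | yes _ = refl
      ...   | no i≰c = contradiction i≤c i≰c
    ... | no i≰c = (λ { refl → i≰c ℕ.≤-refl }) , colour
      where
      colour : τ (i , s) (c , s) ≡ c
      colour with s Bool.≟ s
      ... | no s≢s = contradiction refl s≢s
      ... | yes _ with i Fin.≤? c
      ...   | yes i≤c = contradiction i≤c i≰c
      ...   | no _ = refl

    -- Since i is not c, an edge of colour c must have j = c, and the comparison of i with c decides
    -- which of the two centres y is.
    leaf : ∀ {x y} → proj₁ x ≢ c → T x y → y ≡ par x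
    leaf {i , s} {j , t} i≢c (_ , eq) with s Bool.≟ t
    leaf {i , s} {j , t} i≢c (_ , eq) | yes refl with i Fin.≤? j | i Fin.≤? c
    ... | yes i≤j | _ = contradiction eq i≢c
    ... | no _ | no _ = cong (_, s) eq
    ... | no i≰j | yes i≤c = contradiction (subst (i Fin.≤_) (sym eq) i≤c) i≰j
    leaf {i , s} {j , t} i≢c (_ , eq) | no s≢t with i Fin.≤? j | i Fin.≤? c
    ... | yes _ | yes _ = cong₂ _,_ eq (Bool.¬-not (≢-sym s≢t))
    ... | yes i≤j | no i≰c = contradiction (subst (i Fin.≤_) eq i≤j) i≰c
    ... | no _ | _ = contradiction eq i≢c

    centre-edge : ∀ {x y} → proj₁ x ≡ c → proj₁ y ≡ c → x ≢ y → y ≡ par x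
    centre-edge {_ , s} {_ , t} refl refl x≢y =
      trans (cong (c ,_) (Bool.¬-not (≢-sym x≢y ∘ cong (c ,_)))) (sym (par-of-centre s))

    centre : ∀ (x : X) → proj₁ x ≡ c ⊎ proj₁ x ≢ c
    centre (i , _) with i Fin.≟ c
    ... | yes i≡c = inj₁ i≡c
    ... | no i≢c = inj₂ i≢c

    centres-connected : ∀ {x y} → proj₁ x ≡ c → proj₁ y ≡ c → Star T x y
    centres-connected {x} {y} x-centre y-centre with x ≟X y
    ... | yes refl = ε
    ... | no x≢y = subst (T x) (sym (centre-edge x-centre y-centre x≢y)) (par-edge x) ◅ ε

    connected : ∀ x y → Star T x y
    connected x y =
      par-edge x ◅ centres-connected (par-centre x) (par-centre y) ◅◅ T-sym (par-edge y) ◅ ε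

    -- A coarse distance from r in the double star: first r, then the centres in the order in which
    -- they are met, then all remaining vertices at once. Leaves are pairwise non-adjacent, so one
    -- value suffices for them.
    rank : X → X → ℕ
    rank r x with x ≟X r | x ≟X par r | x ≟X par (par r)
    ... | yes _ | _ | _ = 0
    ... | no _ | yes _ | _ = 1
    ... | no _ | no _ | yes _ = 2
    ... | no _ | no _ | no _ = 3

    rank-root : ∀ r → rank r r ≡ 0
    rank-root r with r ≟X r
    ... | yes _ = refl
    ... | no r≢r = contradiction refl r≢r

    rank-zero : ∀ r x → rank r x ≤ 0 → x ≡ r
    rank-zero r x le with x ≟X r | x ≟X par r | x ≟X par (par r)
    ... | yes eq | _ | _ = eq
    rank-zero r x () | no _ | yes _ | _
    rank-zero r x () | no _ | no _ | yes _
    rank-zero r x () | no _ | no _ | no _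

    up : X → X → X
    up r x with x ≟X par r
    ... | yes _ = r
    ... | no _ = par x

    par³ : ∀ x → par (par (par x)) ≡ par x
    par³ x with par x | par-centre x
    ... | _ , s | refl = trans (cong par (par-of-centre s))
      (trans (par-of-centre (not s)) (cong (c ,_) (Bool.not-involutive s)))

    -- `up r x` is the next vertex on the way to r. A vertex of rank three is a leaf, with `par x`
    -- as its only neighbour; for the other vertices the small ranks leave few candidates for y.
    lower-neighbour : ∀ r {x y} → T x y → rank r y ≤ rank r x → y ≡ up r x
    lower-neighbour r {x} {y} x~y@(x≢y , _) y≤x with x ≟X r | x ≟X par r | x ≟X par (par r)
    ... | yes refl | _ | _ = contradiction (sym (rank-zero r y y≤x)) x≢y
    ... | no x≢r | yes refl | _ = low y≤x
      where
      low : rank r y ≤ 1 → y ≡ r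
      low le with y ≟X r | y ≟X par r | y ≟X par (par r)
      ... | yes eq | _ | _ = eq
      ... | no _ | yes eq | _ = contradiction (sym eq) x≢y
      low (s≤s ()) | no _ | no _ | yes _
      low (s≤s ()) | no _ | no _ | no _
    ... | no x≢r | no x≢par | yes refl = low y≤x
      where
      low : rank r y ≤ 2 → y ≡ par x
      low le with y ≟X r | y ≟X par r | y ≟X par (par r)
      ... | no _ | yes eq | _ = trans eq (sym (par³ r))
      ... | no _ | no _ | yes eq = contradiction (sym eq) x≢y
      low (s≤s (s≤s ())) | no _ | no _ | no _
      low le | yes refl | _ | _ with centre r
      ...   | inj₁ r-centre = centre-edge (par-centre (par r)) r-centre x≢y
      ...   | inj₂ r-leaf = contradiction (leaf r-leaf (T-sym x~y)) x≢par
    ... | no x≢r | no x≢par | no x≢par² with centre x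
    ...   | inj₁ x-centre = contradiction (centre-edge (par-centre r) x-centre (≢-sym x≢par)) x≢par²
    ...   | inj₂ x-leaf = leaf x-leaf x~y

    lower-unique : ∀ r {x y z} → T x y → T x z → rank r y ≤ rank r x → rank r z ≤ rank r x → y ≡ z
    lower-unique r x~y x~z y≤x z≤x =
      trans (lower-neighbour r x~y y≤x) (sym (lower-neighbour r x~z z≤x))

-- Orbits of an involution on a finite set.

record Enumeration {n : ℕ} (P : Fin n → Set) : Set where
  field
    size : ℕ
    element : Fin size → Fin n
    element-∈ : ∀ j → P (element j)
    position : ∀ i → P i → ∃ λ j → element j ≡ i
    element-injective : ∀ {j k} → element j ≡ element k → j ≡ k

enumerate : ∀ n {P : Fin n → Set} → Decidable P → Enumeration P
enumerate zero P? = record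
  { size = 0 ; element = λ () ; element-∈ = λ () ; position = λ () ; element-injective = λ { {()} } }
enumerate (suc n) {P} P? with P? zero | enumerate n (P? ∘ suc)
... | no ¬p | r = record
  { size = size
  ; element = suc ∘ element
  ; element-∈ = element-∈
  ; position = λ { zero p → contradiction p ¬p
                 ; (suc i) p → let j , eq = position i p in j , cong suc eq }
  ; element-injective = element-injective ∘ Fin.suc-injective }
  where open Enumeration r
... | yes p₀ | r = record
  { size = suc size
  ; element = element′
  ; element-∈ = λ { zero → p₀ ; (suc j) → element-∈ j }
  ; position = λ { zero _ → zero , refl
                 ; (suc i) p → let j , eq = position i p in suc j , cong suc eq }
  ; element-injective = injective }
  where
  open Enumeration r
  element′ : Fin (suc size) → Fin (suc n)
  element′ zero = zero
  element′ (suc j) = suc (element j)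
  injective : ∀ {j k} → element′ j ≡ element′ k → j ≡ k
  injective {zero} {zero} _ = refl
  injective {suc j} {suc k} eq = cong suc (element-injective (Fin.suc-injective eq))

record Orbits {n : ℕ} (σ : Fin n → Fin n) : Set where
  field
    count : ℕ
    orbit : Fin n → Fin count
    rep : Fin count → Fin n
    orbit-rep : ∀ j → orbit (rep j) ≡ j
    orbit-σ : ∀ i → orbit (σ i) ≡ orbit i
    same-orbit : ∀ {i j} → orbit i ≡ orbit j → i ≡ j ⊎ i ≡ σ j

-- Each orbit is represented by its smaller element, so the orbits are enumerated by the i with i ≤
-- σ i.
orbits : ∀ {n} (σ : Fin n → Fin n) → (∀ i → σ (σ i) ≡ i) → Orbits σ
orbits {n} σ σ-invol = record
  { count = size
  ; orbit = orbit
  ; rep = element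
  ; orbit-rep = λ j → element-injective (trans (element-orbit (element j)) (min-fixed (element-∈ j)))
  ; orbit-σ = λ i → element-injective (trans (element-orbit (σ i)) (trans (min-σ i) (sym (element-orbit i))))
  ; same-orbit = λ {i} {j} eq →
      same-min (trans (sym (element-orbit i)) (trans (cong element eq) (element-orbit j))) }
  where
  Minimal : Fin n → Set
  Minimal i = i Fin.≤ σ i

  open Enumeration (enumerate n {Minimal} (λ i → i Fin.≤? σ i))

  min : Fin n → Fin n
  min i with i Fin.≤? σ i
  ... | yes _ = i
  ... | no _ = σ i

  min-minimal : ∀ i → Minimal (min i)
  min-minimal i with i Fin.≤? σ i
  ... | yes i≤ = i≤
  ... | no i≰ = subst (σ i Fin.≤_) (sym (σ-invol i)) (ℕ.<⇒≤ (ℕ.≰⇒> i≰))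

  min-fixed : ∀ {i} → Minimal i → min i ≡ i
  min-fixed {i} i≤ with i Fin.≤? σ i
  ... | yes _ = refl
  ... | no i≰ = contradiction i≤ i≰

  min-σ : ∀ i → min (σ i) ≡ min i
  min-σ i with σ i Fin.≤? σ (σ i) | i Fin.≤? σ i
  ... | yes p | yes q = Fin.≤-antisym (subst (σ i Fin.≤_) (σ-invol i) p) q
  ... | yes _ | no _ = refl
  ... | no _ | yes _ = σ-invol i
  ... | no p | no q = contradiction (subst (σ i Fin.≤_) (sym (σ-invol i)) (ℕ.<⇒≤ (ℕ.≰⇒> q))) p

  min-cases : ∀ i → min i ≡ i ⊎ min i ≡ σ i
  min-cases i with i Fin.≤? σ i
  ... | yes _ = inj₁ refl
  ... | no _ = inj₂ refl

  same-min : ∀ {i j} → min i ≡ min j → i ≡ j ⊎ i ≡ σ j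
  same-min {i} {j} eq with min-cases i | min-cases j
  ... | inj₁ p | inj₁ q = inj₁ (trans (sym p) (trans eq q))
  ... | inj₁ p | inj₂ q = inj₂ (trans (sym p) (trans eq q))
  ... | inj₂ p | inj₁ q = inj₂ (trans (sym (σ-invol i)) (cong σ (trans (sym p) (trans eq q))))
  ... | inj₂ p | inj₂ q =
    inj₁ (trans (sym (σ-invol i)) (trans (cong σ (trans (sym p) (trans eq q))) (σ-invol j)))

  orbit : Fin n → Fin size
  orbit i = proj₁ (position (min i) (min-minimal i))

  element-orbit : ∀ i → element (orbit i) ≡ min i
  element-orbit i = proj₂ (position (min i) (min-minimal i))

module _ {n : ℕ} {σ : Fin n → Fin n} (O : Orbits σ) where
  open Orbits O

  -- An element is determined by its orbit together with whether it is the chosen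
  -- representative; a fixed point leaves one of the 2 · count possible values unused.
  orbits-count : ∀ z → σ z ≡ z → suc n ≤ count ℕ.* 2
  orbits-count z σz≡z = Fin.injective⇒≤ {f = tag} tag-injective
    where
    flag : Fin n → Fin 2
    flag i with rep (orbit i) Fin.≟ i
    ... | yes _ = zero
    ... | no _ = suc zero

    tag : Fin (suc n) → Fin (count ℕ.* 2)
    -- The additional element receives the value left free: z is alone in its orbit, so it is its
    -- own representative and has flag `zero`.
    tag zero = combine (orbit z) (suc zero)
    tag (suc i) = combine (orbit i) (flag i)

    z-unflagged : ∀ i → orbit z ≡ orbit i → suc zero ≢ flag i
    z-unflagged i eq with rep (orbit i) Fin.≟ i
    ... | yes _ = λ ()
    ... | no rep≢i = λ _ → rep≢i (all-z (same-orbit (orbit-rep (orbit i))))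
      where
      i≡z : i ≡ z
      i≡z with same-orbit (sym eq)
      ... | inj₁ i≡z = i≡z
      ... | inj₂ i≡σz = trans i≡σz σz≡z
      all-z : rep (orbit i) ≡ i ⊎ rep (orbit i) ≡ σ i → rep (orbit i) ≡ i
      all-z (inj₁ e) = e
      all-z (inj₂ e) = trans e (trans (cong σ i≡z) (trans σz≡z (sym i≡z)))

    σ-injective-on-orbit : ∀ {i j} → orbit i ≡ orbit j → rep (orbit i) ≢ i → rep (orbit j) ≢ j → i ≡ j
    σ-injective-on-orbit {i} {j} eq r≢i r≢j with same-orbit eq
    ... | inj₁ i≡j = i≡j
    ... | inj₂ i≡σj with same-orbit (orbit-rep (orbit j))
    ...   | inj₁ r≡j = contradiction r≡j r≢j
    ...   | inj₂ r≡σj = contradiction (trans (cong rep eq) (trans r≡σj (sym i≡σj))) r≢i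

    flag-injective : ∀ {i j} → orbit i ≡ orbit j → flag i ≡ flag j → i ≡ j
    flag-injective {i} {j} eq with rep (orbit i) Fin.≟ i | rep (orbit j) Fin.≟ j
    ... | yes p | yes q = λ _ → trans (sym p) (trans (cong rep eq) q)
    ... | yes _ | no _ = λ ()
    ... | no _ | yes _ = λ ()
    ... | no p | no q = λ _ → σ-injective-on-orbit eq p q

    tag-injective : ∀ {i j} → tag i ≡ tag j → i ≡ j
    tag-injective {zero} {zero} _ = refl
    tag-injective {zero} {suc j} eq =
      let o , f = Fin.combine-injective (orbit z) (suc zero) (orbit j) (flag j) eq
      in contradiction f (z-unflagged j o)
    tag-injective {suc i} {zero} eq =
      let o , f = Fin.combine-injective (orbit i) (flag i) (orbit z) (suc zero) eq
      in contradiction (sym f) (z-unflagged i (sym o))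
    tag-injective {suc i} {suc j} eq =
      let o , f = Fin.combine-injective (orbit i) (flag i) (orbit j) (flag j) eq
      in cong suc (flag-injective o f)

-- The colouring obtained from a planar difference set.

module DifferenceSetColouring {n h : ℕ} {_∙_ : Fin n → Fin n → Fin n} {1# : Fin n} {_⁻¹ : Fin n → Fin n}
  (isAbelianGroup : IsAbelianGroup _≡_ _∙_ 1# _⁻¹)
  (δ : Fin h × Bool → Fin n)
  (difference : ∀ g → ∃₂ λ i j → g ∙ δ i ≡ δ j)
  (sidon : ∀ {i j k l} → δ i ∙ δ j ≡ δ k ∙ δ l → i ≡ k ⊎ i ≡ l) where

  open DoubleStars h

  G : AbelianGroup _ _
  G = record { isAbelianGroup = isAbelianGroup }

  open AbelianGroup G using (assoc; comm; identityʳ; inverseˡ; inverseʳ; commutativeSemigroup)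
  open import Algebra.Properties.AbelianGroup G using (⁻¹-involutive; ε⁻¹≈ε; ∙-cancelˡ; ∙-cancelʳ)
  open import Algebra.Properties.CommutativeSemigroup commutativeSemigroup using (interchange)

  δ-injective : ∀ {i j} → δ i ≡ δ j → i ≡ j
  δ-injective eq with sidon (cong₂ _∙_ eq eq)
  ... | inj₁ i≡j = i≡j
  ... | inj₂ i≡j = i≡j

  index-unique : ∀ {i j u} → δ i ∙ u ≡ δ j ∙ u → i ≡ j
  index-unique eq = δ-injective (∙-cancelʳ _ _ _ eq)

  -- Multiplying the first equation by the reversed second one lets `u ∙ v` cancel. This turns two
  -- coincidences of points on two lines into an equation to which `sidon` applies.
  cross : ∀ {a b c d u v} → a ∙ u ≡ b ∙ v → c ∙ u ≡ d ∙ v → a ∙ d ≡ c ∙ b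
  cross {a} {b} {c} {d} {u} {v} au≡bv cu≡dv = ∙-cancelʳ (u ∙ v) _ _ (begin
    (a ∙ d) ∙ (u ∙ v) ≡⟨ interchange a d u v ⟩
    (a ∙ u) ∙ (d ∙ v) ≡⟨ cong₂ _∙_ au≡bv (sym cu≡dv) ⟩
    (b ∙ v) ∙ (c ∙ u) ≡⟨ comm _ _ ⟩
    (c ∙ u) ∙ (b ∙ v) ≡⟨ interchange c u b v ⟩
    (c ∙ b) ∙ (u ∙ v) ∎)
    where open ≡-Reasoning

  abstract
    -- By `difference`, `u ∙ (v ⁻¹)` is a quotient of two values of δ, and clearing denominators
    -- gives a common point of the two lines.
    meet : ∀ u v → ∃₂ λ i j → δ i ∙ u ≡ δ j ∙ v
    meet u v with difference (u ∙ (v ⁻¹))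
    ... | i , j , eq = i , j , (begin
      δ i ∙ u                     ≡⟨ comm _ _ ⟩
      u ∙ δ i                     ≡⟨ cong (_∙ δ i) (sym (identityʳ u)) ⟩
      (u ∙ 1#) ∙ δ i              ≡⟨ cong (λ x → (u ∙ x) ∙ δ i) (sym (inverseˡ v)) ⟩
      (u ∙ ((v ⁻¹) ∙ v)) ∙ δ i    ≡⟨ cong (_∙ δ i) (sym (assoc u (v ⁻¹) v)) ⟩
      ((u ∙ (v ⁻¹)) ∙ v) ∙ δ i    ≡⟨ assoc _ v (δ i) ⟩
      (u ∙ (v ⁻¹)) ∙ (v ∙ δ i)    ≡⟨ cong ((u ∙ (v ⁻¹)) ∙_) (comm v (δ i)) ⟩
      (u ∙ (v ⁻¹)) ∙ (δ i ∙ v)    ≡⟨ sym (assoc _ (δ i) v) ⟩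
      ((u ∙ (v ⁻¹)) ∙ δ i) ∙ v    ≡⟨ cong (_∙ v) eq ⟩
      δ j ∙ v                     ∎)
      where open ≡-Reasoning

  divide : ∀ x y → x ≡ y ∙ (x ∙ (y ⁻¹))
  divide x y = begin
    x                    ≡⟨ sym (identityʳ x) ⟩
    x ∙ 1#               ≡⟨ cong (x ∙_) (sym (inverseʳ y)) ⟩
    x ∙ (y ∙ (y ⁻¹))     ≡⟨ sym (assoc x y (y ⁻¹)) ⟩
    (x ∙ y) ∙ (y ⁻¹)     ≡⟨ cong (_∙ (y ⁻¹)) (comm x y) ⟩
    (y ∙ x) ∙ (y ⁻¹)     ≡⟨ assoc y x (y ⁻¹) ⟩
    y ∙ (x ∙ (y ⁻¹))     ∎
    where open ≡-Reasoning

  abstract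
    -- The line with parameter u is { δ i ∙ u }.
    join : ∀ p r → ∃ λ u → ∃₂ λ i j → p ≡ δ i ∙ u × r ≡ δ j ∙ u
    join p r with meet p r
    ... | j , i , eq = r ∙ (δ j ⁻¹) , i , j , p≡ , divide r (δ j)
      where
      open ≡-Reasoning
      p≡ : p ≡ δ i ∙ (r ∙ (δ j ⁻¹))
      p≡ = begin
        p                           ≡⟨ divide p (δ j) ⟩
        δ j ∙ (p ∙ (δ j ⁻¹))        ≡⟨ sym (assoc _ _ _) ⟩
        (δ j ∙ p) ∙ (δ j ⁻¹)        ≡⟨ cong (_∙ (δ j ⁻¹)) eq ⟩
        (δ i ∙ r) ∙ (δ j ⁻¹)        ≡⟨ assoc _ _ _ ⟩
        δ i ∙ (r ∙ (δ j ⁻¹))        ∎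

  -- Of the two alternatives that `sidon` offers after `cross`, i ≢ j leaves only i ≡ k, and
  -- cancelling δ i identifies the lines.
  join-unique : ∀ {i j k l u v} → δ i ∙ u ≡ δ k ∙ v → δ j ∙ u ≡ δ l ∙ v → i ≢ j → i ≡ k × j ≡ l × u ≡ v
  join-unique {i} ik jl i≢j with sidon (cross ik jl)
  ... | inj₁ i≡j = contradiction i≡j i≢j
  ... | inj₂ refl with ∙-cancelˡ (δ i) _ _ ik
  ...   | refl = refl , index-unique jl , refl

  -- Dual to `join-unique`: the two alternatives of `sidon` say that the common points agree or that
  -- the lines do.
  meet-unique : ∀ {i j k l u v} → δ i ∙ u ≡ δ j ∙ v → δ k ∙ u ≡ δ l ∙ v →
    (i ≡ k × j ≡ l) ⊎ (i ≡ j × k ≡ l × u ≡ v)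
  meet-unique {i} ij kl with sidon (cross ij kl)
  ... | inj₁ refl = inj₁ (refl , index-unique (trans (sym ij) kl))
  ... | inj₂ refl with ∙-cancelˡ (δ i) _ _ ij
  ...   | refl = inj₂ (refl , index-unique kl , refl)

  -- p² = δ i ∙ δ j = δ k ∙ δ l, so the Sidon property identifies the two pairs of lines.
  concurrent : ∀ {i j k l u v p} → p ≡ δ i ∙ u → p ≡ δ j ∙ (u ⁻¹) → p ≡ δ k ∙ v → p ≡ δ l ∙ (v ⁻¹) →
    u ≡ v ⊎ u ≡ v ⁻¹
  concurrent {i} {j} {k} {l} {u} {v} {p} p≡i p≡j p≡k p≡l
    with sidon (trans (sym (square p≡i p≡j)) (square p≡k p≡l))
    where
    square : ∀ {a b x} → p ≡ a ∙ x → p ≡ b ∙ (x ⁻¹) → p ∙ p ≡ a ∙ b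
    square {a} {b} {x} p≡a p≡b = begin
      p ∙ p                      ≡⟨ cong₂ _∙_ p≡a p≡b ⟩
      (a ∙ x) ∙ (b ∙ (x ⁻¹))     ≡⟨ interchange a x b (x ⁻¹) ⟩
      (a ∙ b) ∙ (x ∙ (x ⁻¹))     ≡⟨ cong ((a ∙ b) ∙_) (inverseʳ x) ⟩
      (a ∙ b) ∙ 1#               ≡⟨ identityʳ _ ⟩
      a ∙ b                      ∎
      where open ≡-Reasoning
  ... | inj₁ refl = inj₁ (∙-cancelˡ (δ i) _ _ (trans (sym p≡i) p≡k))
  ... | inj₂ refl = inj₂ (∙-cancelˡ (δ i) _ _ (trans (sym p≡i) p≡l))

  abstract
    O : Orbits _⁻¹
    O = orbits _⁻¹ ⁻¹-involutive

  open Orbits O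

  colour : Fin n → Fin n → Fin (count ℕ.* h)
  colour p r with join p r
  ... | u , i , j , _ = combine (orbit u) (τ i j)

  -- For distinct points `join-unique` leaves `join` no choice of line and indices, so the colour
  -- can be read off from any representation.
  colour-line : ∀ {i j} u → i ≢ j → colour (δ i ∙ u) (δ j ∙ u) ≡ combine (orbit u) (τ i j)
  colour-line {i} {j} u i≢j with join (δ i ∙ u) (δ j ∙ u)
  ... | v , k , l , ik , jl with join-unique ik jl i≢j
  ...   | refl , refl , refl = refl

  colour-sym : ∀ p r → colour p r ≡ colour r p
  colour-sym p r with p Fin.≟ r
  ... | yes refl = refl
  ... | no p≢r with join p r
  ...   | u , i , j , refl , refl =
    trans (cong (combine (orbit u)) (τ-comm i j)) (sym (colour-line u (≢-sym i≢j)))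
    where
    i≢j : i ≢ j
    i≢j refl = p≢r refl

  colouring : Colouring n (count ℕ.* h)
  colouring = record { col = colour ; sym = colour-sym }

  Class : Fin count → Fin h → Rel n
  Class o c = ColourClass colouring (combine o c)

  class-sym : ∀ {i p r} → ColourClass colouring i p r → ColourClass colouring i r p
  class-sym {p = p} {r} (p≢r , eq) = ≢-sym p≢r , trans (colour-sym r p) eq

  class-edge : ∀ {c} u {x y} → Star-at.T c x y → Class (orbit u) c (δ x ∙ u) (δ y ∙ u)
  class-edge u (x≢y , eq) = x≢y ∘ index-unique , trans (colour-line u x≢y) (cong (combine (orbit u)) eq)

  class-edge⁻¹ : ∀ {o c p r} → Class o c p r →
    ∃ λ u → orbit u ≡ o × ∃₂ λ i j → p ≡ δ i ∙ u × r ≡ δ j ∙ u × Star-at.T c i j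
  class-edge⁻¹ {o} {c} {p} {r} (p≢r , eq) with join p r
  ... | u , i , j , refl , refl with Fin.combine-injective (orbit u) (τ i j) o c eq
  ...   | o≡ , c≡ = u , o≡ , i , j , refl , refl , (λ { refl → p≢r refl }) , c≡

  surjective : Surjective colouring
  surjective k with Fin.combine-surjective {count} {h} k
  ... | o , c , refl =
    p , r , subst (λ o′ → Class o′ c p r) (orbit-rep o) (class-edge (rep o) (Star-at.par-edge c (c , true)))
    where
    p = δ (c , true) ∙ rep o
    r = δ (Star-at.par c (c , true)) ∙ rep o

  -- Each colour class is a forest.

  module Forest (w : Fin n) (c : Fin h) where

    open Star-at c

    side : Bool → Fin n
    side true = w
    side false = w ⁻¹

    crossing : ∃₂ λ i j → δ i ∙ w ≡ δ j ∙ (w ⁻¹)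
    crossing = meet w (w ⁻¹)

    -- Both double stars are rooted at the common point of the two lines, so that their ranks agree
    -- there.
    root : Bool → X
    root true = proj₁ crossing
    root false = proj₁ (proj₂ crossing)

    root-eq : δ (root true) ∙ w ≡ δ (root false) ∙ (w ⁻¹)
    root-eq = proj₂ (proj₂ crossing)

    on-line? : ∀ u p → Dec (∃ λ i → p ≡ δ i ∙ u)
    on-line? u p = map′
      (λ { (i , inj₁ eq) → (i , true) , eq ; (i , inj₂ eq) → (i , false) , eq })
      (λ { ((i , true) , eq) → i , inj₁ eq ; ((i , false) , eq) → i , inj₂ eq })
      (Fin.any? (λ i → (p Fin.≟ δ (i , true) ∙ u) ⊎-dec (p Fin.≟ δ (i , false) ∙ u)))

    -- The rank in the double star of the line through p. The common point of two different lines
    -- has rank zero on both; a point on neither line meets no edge of the colour and gets 0.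
    level : Fin n → ℕ
    level p with on-line? w p | on-line? (w ⁻¹) p
    ... | yes (i , _) | _ = rank (root true) i
    ... | no _ | yes (i , _) = rank (root false) i
    ... | no _ | no _ = 0

    level-side : ∀ s i → level (δ i ∙ side s) ≡ rank (root s) i
    level-side true i with on-line? w (δ i ∙ w)
    ... | yes (j , eq) = cong (rank (root true)) (index-unique (sym eq))
    ... | no ¬on = contradiction (i , refl) ¬on
    level-side false i with on-line? w (δ i ∙ (w ⁻¹)) | on-line? (w ⁻¹) (δ i ∙ (w ⁻¹))
    ... | no _ | yes (j , eq) = cong (rank (root false)) (index-unique (sym eq))
    ... | no _ | no ¬on = contradiction (i , refl) ¬on
    ... | yes (j , eq) | _ with meet-unique (sym eq) root-eq
    ...   | inj₁ (refl , refl) = trans (rank-root (root true)) (sym (rank-root (root false)))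
    ...   | inj₂ (refl , roots , _) = cong (λ r → rank r i) roots

    level-≤ : ∀ {s i j} → level (δ j ∙ side s) ≤ level (δ i ∙ side s) → rank (root s) j ≤ rank (root s) i
    level-≤ {s} {i} {j} = subst₂ _≤_ (level-side s j) (level-side s i)

    root-minimal : ∀ s {j} → T (root s) j → ¬ level (δ j ∙ side s) ≤ level (δ (root s) ∙ side s)
    root-minimal s {j} (r≢j , _) le =
      r≢j (sym (rank-zero (root s) j (ℕ.≤-trans (level-≤ {s} le) (ℕ.≤-reflexive (rank-root (root s))))))

    -- Within one line this is `lower-unique`. Edges on two different lines can only share the
    -- common point, which is the root of both double stars and has no lower neighbour.
    lines-unique : ∀ s t {i j k l} → δ i ∙ side s ≡ δ k ∙ side t → T i j → T k l →
      level (δ j ∙ side s) ≤ level (δ i ∙ side s) → level (δ l ∙ side t) ≤ level (δ k ∙ side t) →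
      δ j ∙ side s ≡ δ l ∙ side t
    lines-unique true true eq x y lx ly with index-unique eq
    ... | refl =
      cong (λ z → δ z ∙ w) (lower-unique (root true) x y (level-≤ {true} lx) (level-≤ {true} ly))
    lines-unique false false eq x y lx ly with index-unique eq
    ... | refl =
      cong (λ z → δ z ∙ (w ⁻¹)) (lower-unique (root false) x y (level-≤ {false} lx) (level-≤ {false} ly))
    lines-unique true false eq x y lx ly with meet-unique eq root-eq
    ... | inj₁ (refl , refl) = contradiction lx (root-minimal true x)
    ... | inj₂ (refl , roots , w≡) =
      cong₂ (λ z u → δ z ∙ u)
        (lower-unique (root true) x y (level-≤ {true} lx)
          (subst (λ r → rank r _ ≤ rank r _) (sym roots) (level-≤ {false} ly))) w≡
    lines-unique false true eq x y lx ly = sym (lines-unique true false (sym eq) y x ly lx)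

    which-side : ∀ {u} → orbit u ≡ orbit w → ∃ λ s → u ≡ side s
    which-side eq with same-orbit eq
    ... | inj₁ u≡w = true , u≡w
    ... | inj₂ u≡w⁻¹ = false , u≡w⁻¹

    down-unique : ∀ {v x y} → Class (orbit w) c v x → Class (orbit w) c v y →
      level x ≤ level v → level y ≤ level v → x ≡ y
    down-unique vx vy lx ly with class-edge⁻¹ vx | class-edge⁻¹ vy
    ... | u , ou , i , j , refl , refl , ij | u′ , ou′ , k , l , eq , refl , kl
      with which-side ou | which-side ou′
    ...   | s , refl | t , refl =
      lines-unique s t eq ij kl lx (subst (λ v → level (δ l ∙ side t) ≤ level v) eq ly)

    acyclic : Acyclic (Class (orbit w) c)
    acyclic = Ranking.acyclic class-sym level down-unique

  all-acyclic : ∀ i → Acyclic (ColourClass colouring i)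
  all-acyclic k with Fin.combine-surjective {count} {h} k
  ... | o , c , refl = subst (λ o′ → Acyclic (Class o′ c)) (orbit-rep o) (Forest.acyclic (rep o) c)

  -- Any two colour classes together contain a cycle.

  Covers : Fin count → Fin n → Set
  Covers o p = ∃ λ u → orbit u ≡ o × ∃ λ i → p ≡ δ i ∙ u

  line-connected : ∀ u c i j → Star (Class (orbit u) c) (δ i ∙ u) (δ j ∙ u)
  line-connected u c i j = Star.gmap (λ x → δ x ∙ u) (class-edge u) (Star-at.connected c i j)

  -- The walk follows one line to its common point with the other line, and then the other line.
  class-connected : ∀ {o p r} c → Covers o p → Covers o r → Star (Class o c) p r
  class-connected c (u , refl , i , refl) (v , v~u , k , refl) with meet u v
  ... | a , b , eq = subst (Star _ _) eq (line-connected u c i a) ◅◅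
      subst (λ o → Star (Class o c) _ _) v~u (line-connected v c b k)

  -- The line of u meets those of v and v⁻¹, and the line of u⁻¹ meets that of v; all three points
  -- are covered by both orbits. If they coincided, all four lines would be concurrent, contrary to
  -- `concurrent`.
  two-common-points : ∀ {o₁ o₂} → o₁ ≢ o₂ →
    ∃₂ λ p r → p ≢ r × Covers o₁ p × Covers o₁ r × Covers o₂ p × Covers o₂ r
  two-common-points {o₁} {o₂} o₁≢o₂
    with rep o₁ | orbit-rep o₁ | rep o₂ | orbit-rep o₂
  ... | u | refl | v | refl with meet u v | meet u (v ⁻¹) | meet (u ⁻¹) v
  ...   | i , j , p≡ | k , l , r≡ | a , b , s≡ with δ i ∙ u Fin.≟ δ k ∙ u | δ i ∙ u Fin.≟ δ a ∙ (u ⁻¹)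
  ...     | no p≢r | _ = _ , _ , p≢r , (u , refl , i , refl) , (u , refl , k , refl) ,
                          (v , refl , j , p≡) , (v ⁻¹ , orbit-σ v , l , r≡)
  ...     | yes _ | no p≢s = _ , _ , p≢s , (u , refl , i , refl) , (u ⁻¹ , orbit-σ u , a , refl) ,
                          (v , refl , j , p≡) , (v , refl , b , s≡)
  ...     | yes p≡r | yes p≡s with concurrent refl p≡s p≡ (trans p≡r r≡)
  ...       | inj₁ u≡v = contradiction (cong orbit u≡v) o₁≢o₂
  ...       | inj₂ u≡v⁻¹ = contradiction (trans (cong orbit u≡v⁻¹) (orbit-σ v)) o₁≢o₂

  common-points : ∀ o₁ o₂ → Fin h →
    ∃₂ λ p r → p ≢ r × Covers o₁ p × Covers o₁ r × Covers o₂ p × Covers o₂ r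
  common-points o₁ o₂ c with o₁ Fin.≟ o₂
  ... | no o₁≢o₂ = two-common-points o₁≢o₂
  -- Both colours use the same lines, so any two points of one line will do; the index `c` supplies
  -- the two centres.
  ... | yes refl = _ , _ , proj₁ (par-edge (c , true)) ∘ index-unique , on _ , on _ , on _ , on _
    where
    open Star-at c
    on : ∀ i → Covers o₁ (δ i ∙ rep o₁)
    on i = rep o₁ , orbit-rep o₁ , i , refl

  complete : ∀ i j → i ≢ j → HasCycle (TwoColourClass colouring i j)
  complete k l k≢l with Fin.combine-surjective {count} {h} k | Fin.combine-surjective {count} {h} l
  ... | o₁ , c₁ , refl | o₂ , c₂ , refl with common-points o₁ o₂ c₁
  ...   | p , r , p≢r , p₁ , r₁ , p₂ , r₂ =
    edge-disjoint-walks⇒cycle class-sym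
      (λ (_ , e₁) (_ , e₂) → k≢l (trans (sym e₁) e₂))
      (λ (ne , e) → ne , inj₁ e) (λ (ne , e) → ne , inj₂ e)
      p≢r (class-connected c₂ p₂ r₂) (class-connected c₁ r₁ p₁)

  attainable : Attainable n (count ℕ.* h)
  attainable = colouring , surjective , all-acyclic , complete

  many-orbits : suc n ≤ count ℕ.* 2
  many-orbits = orbits-count O 1# ε⁻¹≈ε

-- Pigeonhole principle and arithmetic modulo the prime q.

injective⇒surjective : ∀ {n} {f : Fin n → Fin n} → (∀ {i j} → f i ≡ f j → i ≡ j) → ∀ m → ∃ λ i → f i ≡ m
injective⇒surjective {suc n} {f} f-injective m with Fin.any? (λ i → f i Fin.≟ m)
... | yes hit = hit
-- Punching out the missed value would embed `Fin (suc n)` into `Fin n`.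
... | no miss = contradiction
  (Fin.injective⇒≤ {f = λ i → punchOut (m≢f i)} (f-injective ∘ Fin.punchOut-injective (m≢f _) (m≢f _)))
  ℕ.1+n≰n
  where
  m≢f : ∀ i → m ≢ f i
  m≢f i m≡fi = miss (i , sym m≡fi)

module Modular {q : ℕ} (q-prime : Prime q) where

  open import Data.Integer using (+_; ∣_∣; _+_; _*_; _-_; -_)

  instance
    q≢0 : NonZero q
    q≢0 = prime⇒nonZero q-prime

  -- Elements of F_q are represented by integers, with equality read as `Z (x - y)`; field
  -- computations thereby become integer ring identities.
  Z : ℤ → Set
  Z x = + q ∣ x

  Z? : ∀ x → Dec (Z x)
  Z? x = + q ∣? x

  Z-≡0 : ∀ {e} → e ≡ 0ℤ → Z e
  Z-≡0 refl = divides 0ℤ refl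

  Z-q : Z (+ q)
  Z-q = divides 1ℤ (sym (ℤ.*-identityˡ (+ q)))

  -- With the two variants below, this is the form of most congruence proofs: an explicit integer
  -- combination of known multiples of q, checked by the ring solver.
  Z-comb₁ : ∀ {x e} a → Z x → e ≡ a * x → Z e
  Z-comb₁ a zx refl = ∣n⇒∣m*n a zx

  Z-comb₂ : ∀ {x y e} a b → Z x → Z y → e ≡ a * x + b * y → Z e
  Z-comb₂ a b zx zy refl = ∣m∣n⇒∣m+n (∣n⇒∣m*n a zx) (∣n⇒∣m*n b zy)

  Z-comb₃ : ∀ {x y z e} a b c → Z x → Z y → Z z → e ≡ a * x + b * y + c * z → Z e
  Z-comb₃ a b c zx zy zz refl = ∣m∣n⇒∣m+n (∣m∣n⇒∣m+n (∣n⇒∣m*n a zx) (∣n⇒∣m*n b zy)) (∣n⇒∣m*n c zz)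

  Z-prime : ∀ x y → Z (x * y) → Z x ⊎ Z y
  Z-prime x y zxy = Sum.map ∣ᵤ⇒∣ ∣ᵤ⇒∣
    (euclidsLemma ∣ x ∣ ∣ y ∣ q-prime (subst (q ℕ.∣_) (ℤ.abs-* x y) (∣⇒∣ᵤ zxy)))

  ¬Z-* : ∀ {x y} → ¬ Z x → ¬ Z y → ¬ Z (x * y)
  ¬Z-* {x} {y} ¬zx ¬zy zxy = [ ¬zx , ¬zy ]′ (Z-prime x y zxy)

  Z-cancel : ∀ x y → ¬ Z x → Z (x * y) → Z y
  Z-cancel x y ¬zx zxy = [ (λ zx → contradiction zx ¬zx) , id ]′ (Z-prime x y zxy)

  ¬Z-1 : ¬ Z 1ℤ
  ¬Z-1 z1 = ¬prime[1] (subst Prime (ℕ.∣1⇒≡1 (∣⇒∣ᵤ z1)) q-prime)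

  val : Fin q → ℤ
  val a = + toℕ a

  reduce : ℤ → Fin q
  reduce x = fromℕ< (n%ℕd<d x q)

  val-reduce : ∀ x → Z (val (reduce x) - x)
  val-reduce x = divides (- (x /ℕ q)) (begin
    + toℕ (reduce x) - x            ≡⟨ cong (λ m → + m - x) (Fin.toℕ-fromℕ< (n%ℕd<d x q)) ⟩
    + r - x                         ≡⟨ cong (λ y → + r - y) (a≡a%ℕn+[a/ℕn]*n x q) ⟩
    + r - (+ r + (x /ℕ q) * + q)    ≡⟨ identity (+ r) (x /ℕ q) (+ q) ⟩
    - (x /ℕ q) * + q                ∎)
    where
    open ≡-Reasoning
    r = x %ℕ q
    identity : ∀ r d q → r - (r + d * q) ≡ - d * q
    identity = solve-∀

  val-injective : ∀ {a b} → Z (val a - val b) → a ≡ b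
  val-injective {a} {b} zab =
    Fin.toℕ-injective (ℤ.+-injective (ℤ.i-j≡0⇒i≡j (val a) (val b) (ℤ.∣i∣≡0⇒i≡0 diff≡0)))
    where
    diff = ∣ val a - val b ∣
    diff<q : diff < q
    diff<q = ℕ.≤-<-trans
      (subst (λ i → ∣ i ∣ ≤ toℕ a ℕ.⊔ toℕ b) (sym (ℤ.m-n≡m⊖n (toℕ a) (toℕ b)))
        (ℤ.∣m⊝n∣≤m⊔n (toℕ a) (toℕ b)))
      (ℕ.⊔-lub (Fin.toℕ<n a) (Fin.toℕ<n b))
    small : ∀ m → q ℕ.∣ m → m < q → m ≡ 0
    small zero _ _ = refl
    small (suc m) q∣m m<q = contradiction q∣m (ℕ.>⇒∤ m<q)
    diff≡0 : diff ≡ 0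
    diff≡0 = small diff (∣⇒∣ᵤ zab) diff<q

  -- Bézout coefficients for q and the residue of x; the inverse is `t` or its negative, according
  -- to which side of the identity over ℕ carries the 1.
  inverse : ∀ x → ¬ Z x → ∃ λ y → Z (x * y - 1ℤ)
  inverse x ¬zx = from-residue (reduce x) (val-reduce x)
    where
    from-residue : ∀ r → Z (val r - x) → ∃ λ y → Z (x * y - 1ℤ)
    from-residue r zr with toℕ r in eq | Fin.toℕ<n r
    ... | zero | _ = contradiction (Z-comb₁ (- 1ℤ) zr (identity x)) ¬zx
      where
      identity : ∀ x → x ≡ - 1ℤ * (0ℤ - x)
      identity = solve-∀
    ... | suc m | r<q with coprime-Bézout (prime⇒coprime {n = suc m} q-prime r<q)
    ...   | Bézout.+- s t e = - (+ t) , Z-comb₂ (+ t) (- (+ s)) zr Z-q (begin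
        x * - (+ t) - 1ℤ
          ≡⟨ cancel x (+ t) (+ suc m) ⟩
        + t * (+ suc m - x) + - 1ℤ * (1ℤ + + t * + suc m)
          ≡⟨ cong (λ y → + t * (+ suc m - x) + - 1ℤ * y) e′ ⟩
        + t * (+ suc m - x) + - 1ℤ * (+ s * + q)
          ≡⟨ rearrange (+ t * (+ suc m - x)) (+ s) (+ q) ⟩
        + t * (+ suc m - x) + - (+ s) * + q ∎)
      where
      open ≡-Reasoning
      e′ : 1ℤ + + t * + suc m ≡ + s * + q
      e′ = trans (cong (λ y → 1ℤ + y) (sym (ℤ.pos-* t (suc m)))) (trans (cong +_ e) (ℤ.pos-* s q))
      cancel : ∀ x t r → x * - t - 1ℤ ≡ t * (r - x) + - 1ℤ * (1ℤ + t * r)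
      cancel = solve-∀
      rearrange : ∀ z s q → z + - 1ℤ * (s * q) ≡ z + - s * q
      rearrange = solve-∀
    ...   | Bézout.-+ s t e = + t , Z-comb₂ (- (+ t)) (+ s) zr Z-q (begin
        x * + t - 1ℤ
          ≡⟨ cancel x (+ t) (+ suc m) ⟩
        - (+ t) * (+ suc m - x) + (+ t * + suc m - 1ℤ)
          ≡⟨ cong (λ y → - (+ t) * (+ suc m - x) + (y - 1ℤ)) (sym e′) ⟩
        - (+ t) * (+ suc m - x) + (1ℤ + + s * + q - 1ℤ)
          ≡⟨ rearrange (- (+ t) * (+ suc m - x)) (+ s) (+ q) ⟩
        - (+ t) * (+ suc m - x) + + s * + q ∎)
      where
      open ≡-Reasoning
      e′ : 1ℤ + + s * + q ≡ + t * + suc m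
      e′ = trans (cong (λ y → 1ℤ + y) (sym (ℤ.pos-* s q))) (trans (cong +_ e) (ℤ.pos-* t (suc m)))
      cancel : ∀ x t r → x * t - 1ℤ ≡ - t * (r - x) + (t * r - 1ℤ)
      cancel = solve-∀
      rearrange : ∀ z s q → z + (1ℤ + s * q - 1ℤ) ≡ z + s * q
      rearrange = solve-∀

  NoRoot : ℤ → Set
  NoRoot k = ∀ t → ¬ Z (t * t * t - t - k)

  -- t³ - t takes the same value at 0 and 1, hence is not surjective modulo q.
  irreducible-cubic : ∃ NoRoot
  irreducible-cubic =
    let k , ¬root = Fin.¬∀⟶∃¬ q HasRoot (λ k → Fin.any? (λ t → Z? (cubic (val t) - val k))) ¬all-roots
    in val k , λ t zt → ¬root (reduce t , reduce-root t (val k) zt)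
    where
    cubic : ℤ → ℤ
    cubic t = t * t * t - t

    HasRoot : Fin q → Set
    HasRoot k = ∃ λ t → Z (cubic (val t) - val k)

    cubic-cong : ∀ t u k →
      u * u * u - u - k ≡ (u * u + u * t + t * t - 1ℤ) * (u - t) + 1ℤ * (t * t * t - t - k)
    cubic-cong = solve-∀

    reduce-root : ∀ t k → Z (cubic t - k) → Z (cubic (val (reduce t)) - k)
    reduce-root t k zt = Z-comb₂ (u * u + u * t + t * t - 1ℤ) 1ℤ (val-reduce t) zt (cubic-cong t u k)
      where u = val (reduce t)

    same-value : ∀ {t u k l} → Z (cubic t - cubic u) → Z (cubic t - val k) → Z (cubic u - val l) → k ≡ l
    same-value {t} {u} {k} {l} tu tk ul =
      val-injective (Z-comb₃ (- 1ℤ) 1ℤ 1ℤ tk tu ul (identity (cubic t) (cubic u) (val k) (val l)))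
      where
      identity : ∀ x y k l → k - l ≡ - 1ℤ * (x - k) + 1ℤ * (x - y) + 1ℤ * (y - l)
      identity = solve-∀

    -- Choosing a root for every k gives an injective, hence surjective, map `root`. So both 0 and 1
    -- are chosen, and as the cubic agrees there, they are chosen for the same k and must be equal.
    ¬all-roots : ¬ (∀ k → HasRoot k)
    ¬all-roots has-root = zero≢one (trans (sym (proj₂ at-zero)) (trans (cong root zero-one) (proj₂ at-one)))
      where
      root : Fin q → Fin q
      root k = proj₁ (has-root k)

      root-injective : ∀ {k l} → root k ≡ root l → k ≡ l
      root-injective {k} {l} eq = same-value {val (root k)} {val (root l)}
        (Z-≡0 (ℤ.i≡j⇒i-j≡0 (cong (cubic ∘ val) eq))) (proj₂ (has-root k)) (proj₂ (has-root l))

      at-zero : ∃ λ k → root k ≡ reduce 0ℤ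
      at-zero = injective⇒surjective root-injective (reduce 0ℤ)

      at-one : ∃ λ k → root k ≡ reduce 1ℤ
      at-one = injective⇒surjective root-injective (reduce 1ℤ)

      root-at : ∀ {t k} → root k ≡ reduce t → Z (cubic t - val k)
      root-at {t} {k} eq = Z-comb₂ (- (u * u + u * t + t * t - 1ℤ)) 1ℤ (val-reduce t)
        (subst (λ r → Z (cubic (val r) - val k)) eq (proj₂ (has-root k))) (cubic-cong⁻¹ t u (val k))
        where
        u = val (reduce t)
        cubic-cong⁻¹ : ∀ t u k →
          t * t * t - t - k ≡ - (u * u + u * t + t * t - 1ℤ) * (u - t) + 1ℤ * (u * u * u - u - k)
        cubic-cong⁻¹ = solve-∀

      zero-one : proj₁ at-zero ≡ proj₁ at-one
      zero-one = same-value {0ℤ} {1ℤ} (Z-≡0 refl) (root-at {0ℤ} (proj₂ at-zero)) (root-at {1ℤ} (proj₂ at-one))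

      zero≢one : reduce 0ℤ ≢ reduce 1ℤ
      zero≢one eq = ¬Z-1 (Z-comb₂ 1ℤ (- 1ℤ)
        (subst (λ r → Z (val r - 0ℤ)) eq (val-reduce 0ℤ)) (val-reduce 1ℤ) (identity (val (reduce 1ℤ))))
        where
        identity : ∀ r → 1ℤ ≡ 1ℤ * (r - 0ℤ) + - 1ℤ * (r - 1ℤ)
        identity = solve-∀

-- The cubic extension ring over the integers.

record Vector : Set where
  constructor ⟨_,_,_⟩
  field
    c₀ c₁ c₂ : ℤ
open Vector

⟨⟩-cong : ∀ {a b c a′ b′ c′} → a ≡ a′ → b ≡ b′ → c ≡ c′ → ⟨ a , b , c ⟩ ≡ ⟨ a′ , b′ , c′ ⟩
⟨⟩-cong refl refl refl = refl

𝟙 : Vector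
𝟙 = ⟨ 1ℤ , 0ℤ , 0ℤ ⟩

-- Multiplication in ℤ[x]/(x³ - x - k), where ⟨ a , b , c ⟩ stands for a + b x + c x².
module Multiplication (k : ℤ) where

  open import Data.Integer using (_+_; _*_)

  infixl 7 _⊗_

  _⊗_ : Vector → Vector → Vector
  ⟨ a , b , c ⟩ ⊗ ⟨ d , e , f ⟩ =
    ⟨ a * d + k * (b * f + c * e)
    , a * e + b * d + (b * f + c * e) + k * (c * f)
    , a * f + b * e + c * d + c * f ⟩

  ⊗-comm : ∀ u v → u ⊗ v ≡ v ⊗ u
  ⊗-comm ⟨ a , b , c ⟩ ⟨ d , e , f ⟩ = ⟨⟩-cong (eq₀ k a b c d e f) (eq₁ k a b c d e f) (eq₂ a b c d e f)
    where
    eq₀ : ∀ k a b c d e f → a * d + k * (b * f + c * e) ≡ d * a + k * (e * c + f * b)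
    eq₀ = solve-∀
    eq₁ : ∀ k a b c d e f → a * e + b * d + (b * f + c * e) + k * (c * f)
      ≡ d * b + e * a + (e * c + f * b) + k * (f * c)
    eq₁ = solve-∀
    eq₂ : ∀ a b c d e f → a * f + b * e + c * d + c * f ≡ d * c + e * b + f * a + f * c
    eq₂ = solve-∀

  ⊗-assoc : ∀ u v w → (u ⊗ v) ⊗ w ≡ u ⊗ (v ⊗ w)
  ⊗-assoc ⟨ a , b , c ⟩ ⟨ d , e , f ⟩ ⟨ g , h , i ⟩ =
    ⟨⟩-cong (eq₀ k a b c d e f g h i) (eq₁ k a b c d e f g h i) (eq₂ k a b c d e f g h i)
    where
    eq₀ : ∀ k a b c d e f g h i →
      (a * d + k * (b * f + c * e)) * g
        + k * ((a * e + b * d + (b * f + c * e) + k * (c * f)) * i + (a * f + b * e + c * d + c * f) * h)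
      ≡ a * (d * g + k * (e * i + f * h))
        + k * (b * (d * i + e * h + f * g + f * i) + c * (d * h + e * g + (e * i + f * h) + k * (f * i)))
    eq₀ = solve-∀
    eq₁ : ∀ k a b c d e f g h i →
      (a * d + k * (b * f + c * e)) * h
        + (a * e + b * d + (b * f + c * e) + k * (c * f)) * g
        + ((a * e + b * d + (b * f + c * e) + k * (c * f)) * i + (a * f + b * e + c * d + c * f) * h)
        + k * ((a * f + b * e + c * d + c * f) * i)
      ≡ a * (d * h + e * g + (e * i + f * h) + k * (f * i))
        + b * (d * g + k * (e * i + f * h))
        + (b * (d * i + e * h + f * g + f * i) + c * (d * h + e * g + (e * i + f * h) + k * (f * i)))
        + k * (c * (d * i + e * h + f * g + f * i))
    eq₁ = solve-∀
    eq₂ : ∀ k a b c d e f g h i →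
      (a * d + k * (b * f + c * e)) * i
        + (a * e + b * d + (b * f + c * e) + k * (c * f)) * h
        + (a * f + b * e + c * d + c * f) * g
        + (a * f + b * e + c * d + c * f) * i
      ≡ a * (d * i + e * h + f * g + f * i)
        + b * (d * h + e * g + (e * i + f * h) + k * (f * i))
        + c * (d * g + k * (e * i + f * h))
        + c * (d * i + e * h + f * g + f * i)
    eq₂ = solve-∀

  ⊗-identityˡ : ∀ u → 𝟙 ⊗ u ≡ u
  ⊗-identityˡ ⟨ a , b , c ⟩ = ⟨⟩-cong (eq₀ k a b c) (eq₁ k a b c) (eq₂ a b c)
    where
    eq₀ : ∀ k a b c → 1ℤ * a + k * (0ℤ * c + 0ℤ * b) ≡ a
    eq₀ = solve-∀
    eq₁ : ∀ k a b c → 1ℤ * b + 0ℤ * a + (0ℤ * c + 0ℤ * b) + k * (0ℤ * c) ≡ b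
    eq₁ = solve-∀
    eq₂ : ∀ a b c → 1ℤ * c + 0ℤ * b + 0ℤ * a + 0ℤ * c ≡ c
    eq₂ = solve-∀

-- Reduction modulo q: proportionality and inverses of nonzero vectors.

module Singer {q : ℕ} (q-prime : Prime q)
  (k : ℤ) (no-root : Modular.NoRoot q-prime k) where

  open import Data.Integer using (_+_; _*_; _-_; -_)
  open Modular q-prime
  open Multiplication k

  record Zero (u : Vector) : Set where
    constructor ⟪_,_,_⟫
    field
      z₀ : Z (c₀ u)
      z₁ : Z (c₁ u)
      z₂ : Z (c₂ u)

  infix 4 _~_
  -- Proportionality over F_q, which on nonzero vectors is equality in K*/F_q*. Having a nonzero
  -- scalar on each side gives symmetry and transitivity without inverting scalars.
  record _~_ (u v : Vector) : Set where
    constructor ⟦_,_,_,_,_,_,_⟧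
    field
      s t : ℤ
      s≢0 : ¬ Z s
      t≢0 : ¬ Z t
      z₀ : Z (s * c₀ u - t * c₀ v)
      z₁ : Z (s * c₁ u - t * c₁ v)
      z₂ : Z (s * c₂ u - t * c₂ v)

  ~-refl : ∀ u → u ~ u
  ~-refl ⟨ a , b , c ⟩ = ⟦ 1ℤ , 1ℤ , ¬Z-1 , ¬Z-1 , eq a , eq b , eq c ⟧
    where
    eq : ∀ x → Z (1ℤ * x - 1ℤ * x)
    eq x = Z-≡0 (ℤ.i≡j⇒i-j≡0 {1ℤ * x} refl)

  ~-sym : ∀ {u v} → u ~ v → v ~ u
  ~-sym {⟨ a , b , c ⟩} {⟨ d , e , f ⟩} ⟦ s , t , s≢0 , t≢0 , z₀ , z₁ , z₂ ⟧ =
    ⟦ t , s , t≢0 , s≢0 , flip a d z₀ , flip b e z₁ , flip c f z₂ ⟧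
    where
    identity : ∀ s t x y → t * y - s * x ≡ - 1ℤ * (s * x - t * y)
    identity = solve-∀
    flip : ∀ x y → Z (s * x - t * y) → Z (t * y - s * x)
    flip x y z = Z-comb₁ (- 1ℤ) z (identity s t x y)

  ~-trans : ∀ {u v w} → u ~ v → v ~ w → u ~ w
  ~-trans ⟦ s , t , s≢0 , t≢0 , y₀ , y₁ , y₂ ⟧ ⟦ s′ , t′ , s′≢0 , t′≢0 , z₀ , z₁ , z₂ ⟧ =
    ⟦ s * s′ , t * t′ , ¬Z-* s≢0 s′≢0 , ¬Z-* t≢0 t′≢0 , compose y₀ z₀ , compose y₁ z₁ , compose y₂ z₂ ⟧
    where
    identity : ∀ s t s′ t′ x y z → s * s′ * x - t * t′ * z ≡ s′ * (s * x - t * y) + t * (s′ * y - t′ * z)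
    identity = solve-∀
    compose : ∀ {x y z} → Z (s * x - t * y) → Z (s′ * y - t′ * z) → Z (s * s′ * x - t * t′ * z)
    compose {x} {y} {z} p r = Z-comb₂ s′ t p r (identity s t s′ t′ x y z)

  ~-reflexive : ∀ {u v} → u ≡ v → u ~ v
  ~-reflexive {u} refl = ~-refl u

  ⊗-congˡ : ∀ w {u v} → u ~ v → u ⊗ w ~ v ⊗ w
  ⊗-congˡ ⟨ g , h , i ⟩ {⟨ a , b , c ⟩} {⟨ d , e , f ⟩} ⟦ s , t , s≢0 , t≢0 , z₀ , z₁ , z₂ ⟧ =
    ⟦ s , t , s≢0 , t≢0 ,
    Z-comb₃ g (k * i) (k * h) z₀ z₁ z₂ (eq₀ k s t a b c d e f g h i) ,
    Z-comb₃ h (g + i) (h + k * i) z₀ z₁ z₂ (eq₁ k s t a b c d e f g h i) ,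
    Z-comb₃ i h (g + i) z₀ z₁ z₂ (eq₂ s t a b c d e f g h i) ⟧
    where
    eq₀ : ∀ k s t a b c d e f g h i →
      s * (a * g + k * (b * i + c * h)) - t * (d * g + k * (e * i + f * h))
      ≡ g * (s * a - t * d) + k * i * (s * b - t * e) + k * h * (s * c - t * f)
    eq₀ = solve-∀
    eq₁ : ∀ k s t a b c d e f g h i →
      s * (a * h + b * g + (b * i + c * h) + k * (c * i)) - t * (d * h + e * g + (e * i + f * h) + k * (f * i))
      ≡ h * (s * a - t * d) + (g + i) * (s * b - t * e) + (h + k * i) * (s * c - t * f)
    eq₁ = solve-∀
    eq₂ : ∀ s t a b c d e f g h i →
      s * (a * i + b * h + c * g + c * i) - t * (d * i + e * h + f * g + f * i)
      ≡ i * (s * a - t * d) + h * (s * b - t * e) + (g + i) * (s * c - t * f)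
    eq₂ = solve-∀

  ⊗-congʳ : ∀ w {u v} → u ~ v → w ⊗ u ~ w ⊗ v
  ⊗-congʳ w {u} {v} u~v = subst₂ _~_ (⊗-comm u w) (⊗-comm v w) (⊗-congˡ w u~v)

  Zero-~ : ∀ {u v} → u ~ v → Zero u → Zero v
  Zero-~ ⟦ s , t , s≢0 , t≢0 , z₀ , z₁ , z₂ ⟧ ⟪ a , b , c ⟫ = ⟪ descend z₀ a , descend z₁ b , descend z₂ c ⟫
    where
    identity : ∀ s t x y → t * y ≡ s * x + - 1ℤ * (s * x - t * y)
    identity = solve-∀
    descend : ∀ {x y} → Z (s * x - t * y) → Z x → Z y
    descend {x} {y} z zx = Z-cancel t y t≢0 (Z-comb₂ s (- 1ℤ) zx z (identity s t x y))

  Zero-⊗ : ∀ u {v} → Zero v → Zero (u ⊗ v)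
  Zero-⊗ ⟨ a , b , c ⟩ {⟨ d , e , f ⟩} ⟪ zd , ze , zf ⟫ =
    ⟪ Z-comb₃ a (k * c) (k * b) zd ze zf (eq₀ k a b c d e f) ,
    Z-comb₃ b (a + c) (b + k * c) zd ze zf (eq₁ k a b c d e f) ,
    Z-comb₃ c b (a + c) zd ze zf (eq₂ a b c d e f) ⟫
    where
    eq₀ : ∀ k a b c d e f → a * d + k * (b * f + c * e) ≡ a * d + k * c * e + k * b * f
    eq₀ = solve-∀
    eq₁ : ∀ k a b c d e f → a * e + b * d + (b * f + c * e) + k * (c * f)
      ≡ b * d + (a + c) * e + (b + k * c) * f
    eq₁ = solve-∀
    eq₂ : ∀ a b c d e f → a * f + b * e + c * d + c * f ≡ c * d + b * e + (a + c) * f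
    eq₂ = solve-∀

  ¬Zero-𝟙 : ¬ Zero 𝟙
  ¬Zero-𝟙 ⟪ z1 , _ , _ ⟫ = ¬Z-1 z1

  -- a³ - a b² + k b³ is the norm of a + b x.
  anisotropic : ∀ a b → Z (a * a * a - a * b * b + k * b * b * b) → Z b
  anisotropic a b norm with Z? b
  ... | yes zb = zb
  ... | no ¬zb with inverse b ¬zb
  -- If b is invertible, dividing the norm by -b³ shows that -a/b is a root of t³ - t - k.
  ...   | b′ , bb′ = contradiction
    (Z-comb₂ (- (b′ * b′ * b′)) (k * (b * b′ * (b * b′) + b * b′ + 1ℤ) - a * b′ * (b * b′ + 1ℤ))
      norm bb′ (identity k a b b′))
    (no-root (- (a * b′)))
    where
    identity : ∀ k a b b′ →
      - (a * b′) * - (a * b′) * - (a * b′) - - (a * b′) - k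
      ≡ - (b′ * b′ * b′) * (a * a * a - a * b * b + k * b * b * b)
        + (k * (b * b′ * (b * b′) + b * b′ + 1ℤ) - a * b′ * (b * b′ + 1ℤ)) * (b * b′ - 1ℤ)
    identity = solve-∀

  Unit : Vector → Set
  Unit u = ∃ λ w → u ⊗ w ~ 𝟙

  constant-unit : ∀ a b c → ¬ Z a → Z b → Z c → Unit ⟨ a , b , c ⟩
  constant-unit a b c a≢0 zb zc = 𝟙 , subst (_~ 𝟙) (sym (trans (⊗-comm u 𝟙) (⊗-identityˡ u)))
    ⟦ 1ℤ , a , ¬Z-1 , a≢0 , Z-≡0 (eq₀ a) , Z-comb₁ 1ℤ zb (eq a b) , Z-comb₁ 1ℤ zc (eq a c) ⟧
    where
    u = ⟨ a , b , c ⟩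
    eq₀ : ∀ a → 1ℤ * a - a * 1ℤ ≡ 0ℤ
    eq₀ = solve-∀
    eq : ∀ a b → 1ℤ * b - a * 0ℤ ≡ 1ℤ * b
    eq = solve-∀

  -- The witness is the cofactor of a + b x in its norm; the norm is nonzero modulo q by
  -- `anisotropic`.
  linear-unit : ∀ a b c → ¬ Z b → Z c → Unit ⟨ a , b , c ⟩
  linear-unit a b c b≢0 zc =
    ⟨ a * a - b * b , - (a * b) , b * b ⟩ ,
    ⟦ 1ℤ , norm , ¬Z-1 , b≢0 ∘ anisotropic a b ,
    Z-comb₁ (k * - (a * b)) zc (eq₀ k a b c) ,
    Z-comb₁ (- (a * b) + k * (b * b)) zc (eq₁ k a b c) ,
    Z-comb₁ (a * a) zc (eq₂ k a b c) ⟧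
    where
    norm = a * a * a - a * b * b + k * b * b * b
    eq₀ : ∀ k a b c →
      1ℤ * (a * (a * a - b * b) + k * (b * (b * b) + c * - (a * b)))
        - (a * a * a - a * b * b + k * b * b * b) * 1ℤ
      ≡ k * - (a * b) * c
    eq₀ = solve-∀
    eq₁ : ∀ k a b c →
      1ℤ * (a * - (a * b) + b * (a * a - b * b) + (b * (b * b) + c * - (a * b)) + k * (c * (b * b)))
        - (a * a * a - a * b * b + k * b * b * b) * 0ℤ
      ≡ (- (a * b) + k * (b * b)) * c
    eq₁ = solve-∀
    eq₂ : ∀ k a b c →
      1ℤ * (a * (b * b) + b * - (a * b) + c * (a * a - b * b) + c * (b * b))
        - (a * a * a - a * b * b + k * b * b * b) * 0ℤ
      ≡ a * a * c
    eq₂ = solve-∀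

  ≤linear-unit : ∀ u → Z (c₂ u) → ¬ Zero u → Unit u
  ≤linear-unit ⟨ a , b , c ⟩ zc nonzero with Z? b
  ... | yes zb = constant-unit a b c (λ za → nonzero ⟪ za , zb , zc ⟫) zb zc
  ... | no b≢0 = linear-unit a b c b≢0 zc

  -- Multiplying by c x - b lowers the degree; the product vanishes only if b / c is a root of the cubic.
  quadratic-unit : ∀ a b c → ¬ Z c → Unit ⟨ a , b , c ⟩
  quadratic-unit a b c c≢0 =
    let w , unit = ≤linear-unit (ℓ ⊗ u) (Z-≡0 (eq₂ a b c)) remainder≢0
    in ℓ ⊗ w , ~-trans (~-reflexive (trans (sym (⊗-assoc u ℓ w)) (cong (_⊗ w) (⊗-comm u ℓ)))) unit
    where
    u ℓ : Vector
    u = ⟨ a , b , c ⟩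
    ℓ = ⟨ - b , c , 0ℤ ⟩
    eq₂ : ∀ a b c → - b * c + c * b + 0ℤ * a + 0ℤ * c ≡ 0ℤ
    eq₂ = solve-∀
    identity : ∀ k a b c →
      b * b * b - b * (- c) * (- c) + k * (- c) * (- c) * (- c)
      ≡ - c * (- b * a + k * (c * c + 0ℤ * b)) + - b * (- b * b + c * a + (c * c + 0ℤ * b) + k * (0ℤ * c))
    identity = solve-∀
    neg : ∀ c → c ≡ - 1ℤ * - c
    neg = solve-∀
    remainder≢0 : ¬ Zero (ℓ ⊗ u)
    remainder≢0 ⟪ z₀ , z₁ , _ ⟫ =
      c≢0 (Z-comb₁ (- 1ℤ) (anisotropic b (- c) (Z-comb₂ (- c) (- b) z₀ z₁ (identity k a b c))) (neg c))

  nonzero-unit : ∀ u → ¬ Zero u → Unit u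
  nonzero-unit ⟨ a , b , c ⟩ nonzero with Z? c
  ... | yes zc = ≤linear-unit ⟨ a , b , c ⟩ zc nonzero
  ... | no c≢0 = quadratic-unit a b c c≢0

  -- Multiplying a vanishing product by an inverse of u up to scalars would make v vanish.
  ⊗-nonzero : ∀ {u v} → ¬ Zero u → ¬ Zero v → ¬ Zero (u ⊗ v)
  ⊗-nonzero {u} {v} u≢0 v≢0 zero-uv with nonzero-unit u u≢0
  ... | w , unit = v≢0 (subst Zero (⊗-identityˡ v) (Zero-~ (⊗-congˡ v unit)
    (subst Zero (trans (sym (⊗-assoc w u v)) (cong (_⊗ v) (⊗-comm w u))) (Zero-⊗ w zero-uv))))

-- The group K*/F_q* and its Singer difference set.

module SingerGroup {q : ℕ} (q-prime : Prime q)
  (k : ℤ) (no-root : Modular.NoRoot q-prime k) where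

  open import Data.Integer using (_+_; _*_; _-_; -_)
  open Modular q-prime
  open Singer q-prime k no-root
  open Multiplication k

  n : ℕ
  n = q ℕ.* q ℕ.+ q ℕ.+ 1

  -- Each class contains exactly one monic polynomial; counting these by degree two, one and zero
  -- gives q² + q + 1.
  Point : Set
  Point = (Fin q × Fin q ⊎ Fin q) ⊎ Fin 1

  pattern quadratic a b = inj₁ (inj₁ (a , b))
  pattern linear a = inj₁ (inj₂ a)
  pattern constant = inj₂ zero

  points : Fin n ↔ Point
  points = ↔-trans Fin.+↔⊎ (↔-trans Fin.+↔⊎ (Fin.*↔× ⊎-↔ ↔-refl) ⊎-↔ ↔-refl)

  normal : Point → Vector
  normal (quadratic a b) = ⟨ val a , val b , 1ℤ ⟩
  normal (linear a) = ⟨ val a , 1ℤ , 0ℤ ⟩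
  normal constant = 𝟙

  normal-nonzero : ∀ p → ¬ Zero (normal p)
  normal-nonzero (quadratic a b) ⟪ _ , _ , z ⟫ = ¬Z-1 z
  normal-nonzero (linear a) ⟪ _ , z , _ ⟫ = ¬Z-1 z
  normal-nonzero constant ⟪ z , _ , _ ⟫ = ¬Z-1 z

  residue : ∀ x → Z (1ℤ * val (reduce x) - x)
  residue x = Z-comb₁ 1ℤ (val-reduce x) (identity (val (reduce x)) x)
    where
    identity : ∀ r x → 1ℤ * r - x ≡ 1ℤ * (r - x)
    identity = solve-∀

  inverse-sym : ∀ {x y} → Z (x * y - 1ℤ) → Z (1ℤ * 1ℤ - y * x)
  inverse-sym {x} {y} z = Z-comb₁ (- 1ℤ) z (identity x y)
    where
    identity : ∀ x y → 1ℤ * 1ℤ - y * x ≡ - 1ℤ * (x * y - 1ℤ)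
    identity = solve-∀

  inverse≢0 : ∀ {x y} → Z (x * y - 1ℤ) → ¬ Z y
  inverse≢0 {x} {y} z zy = ¬Z-1 (Z-comb₂ x (- 1ℤ) zy z (identity x y))
    where
    identity : ∀ x y → 1ℤ ≡ x * y + - 1ℤ * (x * y - 1ℤ)
    identity = solve-∀

  coefficient-zero : ∀ s t {x} → Z x → Z (s * 0ℤ - t * x)
  coefficient-zero s t {x} zx = Z-comb₁ (- t) zx (identity s t x)
    where
    identity : ∀ s t x → s * 0ℤ - t * x ≡ - t * x
    identity = solve-∀

  normalise : ∀ u → ¬ Zero u → ∃ λ p → normal p ~ u
  normalise ⟨ a , b , c ⟩ u≢0 with Z? c | Z? b
  ... | no c≢0 | _ =
    let y , inv = inverse c c≢0
    in quadratic (reduce (y * a)) (reduce (y * b)) ,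
       ⟦ 1ℤ , y , ¬Z-1 , inverse≢0 {c} inv , residue (y * a) , residue (y * b) , inverse-sym {c} inv ⟧
  ... | yes zc | no b≢0 =
    let y , inv = inverse b b≢0
    in linear (reduce (y * a)) ,
       ⟦ 1ℤ , y , ¬Z-1 , inverse≢0 {b} inv , residue (y * a) , inverse-sym {b} inv , coefficient-zero 1ℤ y zc ⟧
  ... | yes zc | yes zb =
    let y , inv = inverse a (λ za → u≢0 ⟪ za , zb , zc ⟫)
    in constant ,
       ⟦ 1ℤ , y , ¬Z-1 , inverse≢0 {a} inv ,
         inverse-sym {a} inv , coefficient-zero 1ℤ y zb , coefficient-zero 1ℤ y zc ⟧

  ¬unit-zero : ∀ {s t} → ¬ Z s → ¬ Z (s * 1ℤ - t * 0ℤ)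
  ¬unit-zero {s} {t} s≢0 z = s≢0 (Z-comb₁ 1ℤ z (identity s t))
    where
    identity : ∀ s t → s ≡ 1ℤ * (s * 1ℤ - t * 0ℤ)
    identity = solve-∀

  ¬zero-unit : ∀ {s t} → ¬ Z t → ¬ Z (s * 0ℤ - t * 1ℤ)
  ¬zero-unit {s} {t} t≢0 z = t≢0 (Z-comb₁ (- 1ℤ) z (identity s t))
    where
    identity : ∀ s t → t ≡ - 1ℤ * (s * 0ℤ - t * 1ℤ)
    identity = solve-∀

  coefficient-unique : ∀ {s t a b} → ¬ Z s → Z (s * 1ℤ - t * 1ℤ) → Z (s * val a - t * val b) → a ≡ b
  coefficient-unique {s} {t} {a} {b} s≢0 z₁ z = val-injective
    (Z-cancel s (val a - val b) s≢0 (Z-comb₂ 1ℤ (- val b) z z₁ (identity s t (val a) (val b))))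
    where
    identity : ∀ s t a b → s * (a - b) ≡ 1ℤ * (s * a - t * b) + - b * (s * 1ℤ - t * 1ℤ)
    identity = solve-∀

  -- Leading coefficients 1 in equal degree force s and t to agree modulo q, and then the other
  -- coefficients agree; in different degrees s or t would vanish.
  normal-injective : ∀ p r → normal p ~ normal r → p ≡ r
  normal-injective (quadratic a b) (quadratic c d) ⟦ s , t , s≢0 , _ , z₀ , z₁ , z₂ ⟧ =
    cong₂ (λ a b → quadratic a b)
      (coefficient-unique {s} {t} s≢0 z₂ z₀) (coefficient-unique {s} {t} s≢0 z₂ z₁)
  normal-injective (linear a) (linear c) ⟦ s , t , s≢0 , _ , z₀ , z₁ , _ ⟧ =
    cong (λ a → linear a) (coefficient-unique {s} {t} s≢0 z₁ z₀)
  normal-injective constant constant _ = refl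
  normal-injective (quadratic _ _) (linear _) ⟦ s , t , s≢0 , _ , _ , _ , z ⟧ =
    contradiction z (¬unit-zero {s} {t} s≢0)
  normal-injective (quadratic _ _) constant ⟦ s , t , s≢0 , _ , _ , _ , z ⟧ =
    contradiction z (¬unit-zero {s} {t} s≢0)
  normal-injective (linear _) constant ⟦ s , t , s≢0 , _ , _ , z , _ ⟧ =
    contradiction z (¬unit-zero {s} {t} s≢0)
  normal-injective (linear _) (quadratic _ _) ⟦ s , t , _ , t≢0 , _ , _ , z ⟧ =
    contradiction z (¬zero-unit {s} {t} t≢0)
  normal-injective constant (quadratic _ _) ⟦ s , t , _ , t≢0 , _ , _ , z ⟧ =
    contradiction z (¬zero-unit {s} {t} t≢0)
  normal-injective constant (linear _) ⟦ s , t , _ , t≢0 , _ , z , _ ⟧ =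
    contradiction z (¬zero-unit {s} {t} t≢0)

  decode : Fin n → Point
  decode = Inverse.to points

  encode : Point → Fin n
  encode = Inverse.from points

  decode-encode : ∀ p → decode (encode p) ≡ p
  decode-encode p = Inverse.strictlyInverseˡ points p

  encode-decode : ∀ x → encode (decode x) ≡ x
  encode-decode x = Inverse.strictlyInverseʳ points x

  vec : Fin n → Vector
  vec x = normal (decode x)

  vec-nonzero : ∀ x → ¬ Zero (vec x)
  vec-nonzero x = normal-nonzero (decode x)

  vec-encode : ∀ p → vec (encode p) ≡ normal p
  vec-encode p = cong normal (decode-encode p)

  vec-injective : ∀ {x y} → vec x ~ vec y → x ≡ y
  vec-injective {x} {y} x~y =
    trans (sym (encode-decode x))
      (trans (cong encode (normal-injective (decode x) (decode y) x~y)) (encode-decode y))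

  abstract
    class : ∀ u → ¬ Zero u → ∃ λ x → vec x ~ u
    class u u≢0 = let p , p~u = normalise u u≢0 in encode p , subst (_~ u) (sym (vec-encode p)) p~u

  infixl 7 _∙_

  _∙_ : Fin n → Fin n → Fin n
  x ∙ y = proj₁ (class (vec x ⊗ vec y) (⊗-nonzero (vec-nonzero x) (vec-nonzero y)))

  vec-∙ : ∀ x y → vec (x ∙ y) ~ vec x ⊗ vec y
  vec-∙ x y = proj₂ (class (vec x ⊗ vec y) (⊗-nonzero (vec-nonzero x) (vec-nonzero y)))

  identity : Fin n
  identity = proj₁ (class 𝟙 ¬Zero-𝟙)

  vec-identity : vec identity ~ 𝟙
  vec-identity = proj₂ (class 𝟙 ¬Zero-𝟙)

  abstract
    reciprocal : ∀ x → ∃ λ y → vec x ⊗ vec y ~ 𝟙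
    reciprocal x =
      let w , xw~1 = nonzero-unit (vec x) (vec-nonzero x)
          y , y~w = class w (λ w≡0 → ¬Zero-𝟙 (Zero-~ xw~1 (Zero-⊗ (vec x) w≡0)))
      in y , ~-trans (⊗-congʳ (vec x) y~w) xw~1

  _⁻¹ : Fin n → Fin n
  x ⁻¹ = proj₁ (reciprocal x)

  comm : ∀ x y → x ∙ y ≡ y ∙ x
  comm x y = vec-injective
    (~-trans (vec-∙ x y) (~-trans (~-reflexive (⊗-comm (vec x) (vec y))) (~-sym (vec-∙ y x))))

  assoc : ∀ x y z → (x ∙ y) ∙ z ≡ x ∙ (y ∙ z)
  assoc x y z = vec-injective
    (~-trans (vec-∙ (x ∙ y) z) (~-trans (⊗-congˡ (vec z) (vec-∙ x y))
      (~-trans (~-reflexive (⊗-assoc (vec x) (vec y) (vec z)))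
        (~-sym (~-trans (vec-∙ x (y ∙ z)) (⊗-congʳ (vec x) (vec-∙ y z)))))))

  identityˡ : ∀ x → identity ∙ x ≡ x
  identityˡ x = vec-injective
    (~-trans (vec-∙ identity x) (~-trans (⊗-congˡ (vec x) vec-identity) (~-reflexive (⊗-identityˡ (vec x)))))

  inverseʳ : ∀ x → x ∙ (x ⁻¹) ≡ identity
  inverseʳ x = vec-injective
    (~-trans (vec-∙ x (x ⁻¹)) (~-trans (proj₂ (reciprocal x)) (~-sym vec-identity)))

  isAbelianGroup : IsAbelianGroup _≡_ _∙_ identity _⁻¹
  isAbelianGroup = record
    { isGroup = record
      { isMonoid = record
        { isSemigroup = record
          { isMagma = record { isEquivalence = isEquivalence ; ∙-cong = cong₂ _∙_ }
          ; assoc = assoc }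
        ; identity = identityˡ , λ x → trans (comm x identity) (identityˡ x) }
      ; inverse = (λ x → trans (comm (x ⁻¹) x) (inverseʳ x)) , inverseʳ
      ; ⁻¹-cong = cong _⁻¹ }
    ; comm = comm }

  -- The Singer difference set: the classes of the polynomials of degree at most one.
  δ-point : Fin (suc q) → Point
  δ-point zero = constant
  δ-point (suc a) = linear a

  δ : Fin (suc q) → Fin n
  δ i = encode (δ-point i)

  vec-δ : ∀ i → vec (δ i) ≡ normal (δ-point i)
  vec-δ i = vec-encode (δ-point i)

  linear-class : ∀ u → Z (c₂ u) → ¬ Zero u → ∃ λ i → vec (δ i) ~ u
  linear-class u z₂ u≢0 with normalise u u≢0
  ... | constant , p~u = zero , subst (_~ u) (sym (vec-δ zero)) p~u
  ... | linear a , p~u = suc a , subst (_~ u) (sym (vec-δ (suc a))) p~u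
  ... | quadratic _ _ , ⟦ s , t , s≢0 , _ , _ , _ , z ⟧ =
    contradiction (Z-comb₂ 1ℤ t z z₂ (cancel s t (c₂ u))) s≢0
    where
    cancel : ∀ s t x → s ≡ 1ℤ * (s * 1ℤ - t * x) + t * x
    cancel = solve-∀

  -- The x² coefficient of (a + b x + c x²)(d + e x) is b e + c d, which vanishes for d = b and e =
  -- -c. If b and c both vanish modulo q, this choice is zero and 1 serves instead.
  linear-multiple : ∀ u → ∃ λ v → Z (c₂ v) × ¬ Zero v × Z (c₂ (u ⊗ v))
  linear-multiple ⟨ a , b , c ⟩ with Z? b ×-dec Z? c
  ... | yes (_ , zc) = 𝟙 , Z-≡0 refl , ¬Zero-𝟙 , Z-comb₁ 1ℤ zc (top a b c)
    where
    top : ∀ a b c → a * 0ℤ + b * 0ℤ + c * 1ℤ + c * 0ℤ ≡ 1ℤ * c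
    top = solve-∀
  ... | no bc≢0 =
    ⟨ b , - c , 0ℤ ⟩ , Z-≡0 refl ,
    (λ { ⟪ zb , zc , _ ⟫ → bc≢0 (zb , Z-comb₁ (- 1ℤ) zc (neg c)) }) , Z-≡0 (top a b c)
    where
    top : ∀ a b c → a * 0ℤ + b * - c + c * b + c * 0ℤ ≡ 0ℤ
    top = solve-∀
    neg : ∀ c → c ≡ - 1ℤ * - c
    neg = solve-∀

  difference : ∀ g → ∃₂ λ i j → g ∙ δ i ≡ δ j
  difference g =
    let v , zv , v≢0 , zgv = linear-multiple (vec g)
        i , i~v = linear-class v zv v≢0
        j , j~gv = linear-class (vec g ⊗ v) zgv (⊗-nonzero (vec-nonzero g) v≢0)
    in i , j , vec-injective (~-trans (vec-∙ g (δ i)) (~-trans (⊗-congʳ (vec g) i~v) (~-sym j~gv)))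

  -- Up to sign the resultant of two linear polynomials, which vanishes when they are proportional.
  det : Vector → Vector → ℤ
  det u v = c₀ u * c₁ v - c₁ u * c₀ v

  det-zero : ∀ i j → Z (det (normal (δ-point i)) (normal (δ-point j))) → i ≡ j
  det-zero zero zero _ = refl
  det-zero zero (suc b) z = contradiction (Z-comb₁ 1ℤ z (simplify (val b))) ¬Z-1
    where
    simplify : ∀ b → 1ℤ ≡ 1ℤ * (1ℤ * 1ℤ - 0ℤ * b)
    simplify = solve-∀
  det-zero (suc a) zero z = contradiction (Z-comb₁ (- 1ℤ) z (simplify (val a))) ¬Z-1
    where
    simplify : ∀ a → 1ℤ ≡ - 1ℤ * (a * 0ℤ - 1ℤ * 1ℤ)
    simplify = solve-∀
  det-zero (suc a) (suc b) z = cong suc (val-injective (Z-comb₁ 1ℤ z (simplify (val a) (val b))))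
    where
    simplify : ∀ a b → a - b ≡ 1ℤ * (a * 1ℤ - 1ℤ * b)
    simplify = solve-∀

  -- Products of linear polynomials are not reduced, so this is unique factorisation:
  -- the first factor must have a common root with one of the last two.
  product-det : ∀ u v w x → c₂ u ≡ 0ℤ → c₂ v ≡ 0ℤ → c₂ w ≡ 0ℤ → c₂ x ≡ 0ℤ →
    u ⊗ v ~ w ⊗ x → Z (det u w) ⊎ Z (det u x)
  product-det ⟨ a , b , _ ⟩ ⟨ c , d , _ ⟩ ⟨ e , f , _ ⟩ ⟨ g , h , _ ⟩ refl refl refl refl
    ⟦ s , t , _ , t≢0 , z₀ , z₁ , z₂ ⟧ =
    Z-prime (a * f - b * e) (a * h - b * g)
      (Z-cancel t ((a * f - b * e) * (a * h - b * g)) t≢0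
        -- Up to sign, these coefficients evaluate a polynomial of degree two at the root -a/b of
        -- the first factor, multiplied by b²; there `u ⊗ v` vanishes.
        (Z-comb₃ (- (b * b)) (a * b) (- (a * a)) z₀ z₁ z₂ (factor k s t a b c d e f g h)))
    where
    factor : ∀ k s t a b c d e f g h →
      t * ((a * f - b * e) * (a * h - b * g))
      ≡ - (b * b) * (s * (a * c + k * (b * 0ℤ + 0ℤ * d)) - t * (e * g + k * (f * 0ℤ + 0ℤ * h)))
        + a * b * (s * (a * d + b * c + (b * 0ℤ + 0ℤ * d) + k * (0ℤ * 0ℤ))
            - t * (e * h + f * g + (f * 0ℤ + 0ℤ * h) + k * (0ℤ * 0ℤ)))
        + - (a * a) * (s * (a * 0ℤ + b * d + 0ℤ * c + 0ℤ * 0ℤ) - t * (e * 0ℤ + f * h + 0ℤ * g + 0ℤ * 0ℤ))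
    factor = solve-∀

  δ-linear : ∀ i → c₂ (normal (δ-point i)) ≡ 0ℤ
  δ-linear zero = refl
  δ-linear (suc _) = refl

  sidon : ∀ {i j l m} → δ i ∙ δ j ≡ δ l ∙ δ m → i ≡ l ⊎ i ≡ m
  sidon {i} {j} {l} {m} eq = Sum.map (det-zero i l) (det-zero i m)
    (product-det (normal (δ-point i)) (normal (δ-point j)) (normal (δ-point l)) (normal (δ-point m))
      (δ-linear i) (δ-linear j) (δ-linear l) (δ-linear m)
      (subst₂ _~_ (cong₂ _⊗_ (vec-δ i) (vec-δ j)) (cong₂ _⊗_ (vec-δ l) (vec-δ m))
        (~-trans (~-sym (vec-∙ (δ i) (δ j))) (~-trans (~-reflexive (cong vec eq)) (vec-∙ (δ l) (δ m))))))

-- The lower bound.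

open import Data.Nat using (_+_; _*_)

theorem2 : (q : ℕ) → Prime q → q % 2 ≡ 1 →
    (a : ℕ) → IsAchromaticArboricityK (q * q + q + 1) a →
    (q + 1) * ((q * q + q + 1) + 1) ≤ 4 * a
theorem2 q q-prime q-odd a (_ , maximal) = begin
  (q + 1) * (n + 1)       ≡⟨ cong₂ _*_ (ℕ.+-comm q 1) (ℕ.+-comm n 1) ⟩
  suc q * suc n           ≤⟨ ℕ.*-monoʳ-≤ (suc q) many-orbits ⟩
  suc q * (count * 2)     ≡⟨ cong (_* (count * 2)) (sym 2h≡1+q) ⟩
  h * 2 * (count * 2)     ≡⟨ rearrange h count ⟩
  4 * (count * h)         ≤⟨ ℕ.*-monoʳ-≤ 4 (maximal (count * h) attainable) ⟩
  4 * a                   ∎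
  where
  open ℕ.≤-Reasoning
  cubic = Modular.irreducible-cubic q-prime
  open SingerGroup q-prime (proj₁ cubic) (proj₂ cubic)

  -- As q is odd, this is (q + 1)/2.
  h = suc (q ℕ./ 2)

  2h≡1+q : h * 2 ≡ suc q
  2h≡1+q = cong suc (sym (trans (m≡m%n+[m/n]*n q 2) (cong (_+ q ℕ./ 2 * 2) q-odd)))

  rearrange : ∀ h m → h * 2 * (m * 2) ≡ 4 * (m * h)
  rearrange = ℕ-Solver.solve-∀

  -- The q + 1 points of a line are paired up to serve as the vertices of the double stars.
  indices : (Fin h × Bool) ↔ Fin (suc q)
  indices = subst (λ m → (Fin h × Bool) ↔ Fin m) 2h≡1+q
    (↔-trans (↔-refl ×-↔ ↔-sym Fin.2↔Bool) (↔-sym Fin.*↔×))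

  open Inverse indices using (to; from; strictlyInverseˡ; strictlyInverseʳ)

  to-injective : ∀ {x y} → to x ≡ to y → x ≡ y
  to-injective {x} {y} eq = trans (sym (strictlyInverseʳ x)) (trans (cong from eq) (strictlyInverseʳ y))

  difference′ : ∀ g → ∃₂ λ x y → g ∙ δ (to x) ≡ δ (to y)
  difference′ g =
    let i , j , eq = difference g
    in from i , from j ,
       subst₂ (λ i j → g ∙ δ i ≡ δ j) (sym (strictlyInverseˡ i)) (sym (strictlyInverseˡ j)) eq

  sidon′ : ∀ {w x y z} → δ (to w) ∙ δ (to x) ≡ δ (to y) ∙ δ (to z) → w ≡ y ⊎ w ≡ z
  sidon′ {w} {x} {y} {z} eq = Sum.map to-injective to-injective (sidon {to w} {to x} {to y} {to z} eq)

  open DifferenceSetColouring isAbelianGroup (λ x → δ (to x)) difference′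
    (λ {w} {x} {y} {z} → sidon′ {w} {x} {y} {z})
    using (attainable; many-orbits; O)
  open Orbits O using (count)
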